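{- Let $D=(V,A)$ be a loopless digraph, let $\{S,T\}$ be a partition of $V$ with $S\neq\emptyset$ and $T\neq\emptyset$, and let $b\in\mathbb{Z}_{++}^V$ be a positive integer vector on $V$. Then the following linear system in the variable $x\in\mathbb{R}^A$ is box-TDI: \begin{align*} &x(\delta^-(v)) \ge b(v) && \text{for each } v\in T,\\ &x(\delta^+(v)) \ge b(v) && \text{for each } v\in S,\\ &x(C)\ge 1 && \text{for each bicut } C,\\ &x(a)\ge 0 && \text{for each } a\in A. \end{align*}
   Context: For $X\subseteq V$, $\delta^-(X)$ is the set of arcs of $A$ with tail in $V\setminus X$ and head in $X$, and $\delta^+(X)$ is the set of arcs with tail in $X$ and head in $V\setminus X$; $\delta^\pm(v)=\delta^\pm(\{v\})$. For $x\in\mathbb{R}^A$ and $B\subseteq A$, $x(B)=\sum_{a\in B}x(a)$. An arc set $C\subseteq A$ is a bicut if $C=\delta^-(U)$ for some $U\subseteq V$ with either $\emptyset\neq U\subseteq T$ or $T\subseteq U\subsetneq V$.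
   Formalization: The variable x, the box bounds l and u in the definition of box-TDI, and the competing dual vectors range over the rationals instead of the real numbers. -}

module Defs where

open import Data.Bool using (Bool; true; false; if_then_else_; _∧_; _∨_; not)
open import Data.Nat as ℕ using (ℕ; zero; suc)
open import Data.Integer as ℤ using (ℤ)
open import Data.Rational using (ℚ; _/_; _+_; _*_; _≤_; -_; 0ℚ; 1ℚ)
open import Data.Fin using (Fin; zero; suc; _≟_)
open import Data.Vec using (Vec; []; _∷_; lookup)
open import Data.List using (List; []; _∷_; _++_; map; concatMap; length; filterᵇ)
import Data.List as List
open import Data.List.Relation.Unary.All using (All)
open import Data.Product using (_×_; _,_; proj₁; proj₂; ∃; Σ)
open import Relation.Nullary.Decidable using (⌊_⌋)

toℚ : ℤ → ℚ
toℚ z = z / 1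

∑ : {k : ℕ} → (Fin k → ℚ) → ℚ
∑ {zero}  f = 0ℚ
∑ {suc k} f = f zero + ∑ (λ i → f (suc i))

-- a row (α , β) of a system in variables x ∈ ℚ^m stands for  α·x ≥ β
Row : ℕ → Set
Row m = (Fin m → ℚ) × ℚ

System : ℕ → Set
System m = List (Row m)

dot : {m : ℕ} → (Fin m → ℚ) → (Fin m → ℚ) → ℚ
dot c x = ∑ (λ a → c a * x a)

Feasible : {m : ℕ} → System m → (Fin m → ℚ) → Set
Feasible rows x = All (λ r → proj₂ r ≤ dot (proj₁ r) x) rows

HasMinimum : {m : ℕ} → System m → (Fin m → ℚ) → Set
HasMinimum rows c =
  ∃ λ x → Feasible rows x × (∀ x' → Feasible rows x' → dot c x ≤ dot c x')

DualFeasible : {m : ℕ} (rows : System m) → (Fin m → ℚ) → (Fin (length rows) → ℚ) → Set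
DualFeasible rows c y =
  (∀ i → 0ℚ ≤ y i) × (∀ a → ∑ (λ i → y i * proj₁ (List.lookup rows i) a) ≡ c a)
  where open import Relation.Binary.PropositionalEquality using (_≡_)

dualObj : {m : ℕ} (rows : System m) → (Fin (length rows) → ℚ) → ℚ
dualObj rows y = ∑ (λ i → y i * proj₂ (List.lookup rows i))

IntegralDualOptimum : {m : ℕ} (rows : System m) → (Fin m → ℚ) → Set
IntegralDualOptimum rows c =
  Σ (Fin (length rows) → ℤ) λ y →
    DualFeasible rows c (λ i → toℚ (y i)) ×
    (∀ y' → DualFeasible rows c y' → dualObj rows y' ≤ dualObj rows (λ i → toℚ (y i)))

TDI : {m : ℕ} → System m → Set
TDI {m} rows = (c : Fin m → ℤ) → HasMinimum rows (λ a → toℚ (c a)) →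
               IntegralDualOptimum rows (λ a → toℚ (c a))

unitVec : {m : ℕ} → Fin m → ℚ → (Fin m → ℚ)
unitVec a q a' = if ⌊ a ≟ a' ⌋ then q else 0ℚ

allFin : (m : ℕ) → List (Fin m)
allFin m = List.tabulate (λ a → a)

boxRows : {m : ℕ} → (Fin m → ℚ) → (Fin m → ℚ) → System m
boxRows {m} l u =
  map (λ a → (unitVec a 1ℚ , l a)) (allFin m) ++
  map (λ a → (unitVec a (- 1ℚ) , - (u a))) (allFin m)

BoxTDI : {m : ℕ} → System m → Set
BoxTDI {m} rows = (l u : Fin m → ℚ) → TDI (rows ++ boxRows l u)

-- The system of the theorem.
-- Digraph D = (V , A) with V = Fin n, A = Fin m, arc a goes tail a → head a.
-- Subsets of V are Vec Bool n; the partition {S,T} is given by inS (S = true).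

indicator : Bool → ℚ
indicator true  = 1ℚ
indicator false = 0ℚ

allSubsets : (n : ℕ) → List (Vec Bool n)
allSubsets zero    = [] ∷ []
allSubsets (suc n) = concatMap (λ U → (false ∷ U) ∷ (true ∷ U) ∷ []) (allSubsets n)

module _ {n m : ℕ} (tail head : Fin m → Fin n) where

  inU : Vec Bool n → Fin n → Bool
  inU U v = lookup U v

  δ⁻ : Vec Bool n → (Fin m → ℚ)
  δ⁻ U a = indicator (not (inU U (tail a)) ∧ inU U (head a))

  δ⁺ : Vec Bool n → (Fin m → ℚ)
  δ⁺ U a = indicator (inU U (tail a) ∧ not (inU U (head a)))

  singleton : Fin n → Vec Bool n
  singleton v = Data.Vec.tabulate (λ w → ⌊ v ≟ w ⌋)

  allB : {k : ℕ} → (Fin k → Bool) → Bool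
  allB {zero}  f = true
  allB {suc k} f = f zero ∧ allB (λ i → f (suc i))

  anyB : {k : ℕ} → (Fin k → Bool) → Bool
  anyB f = not (allB (λ i → not (f i)))

  -- U defines a bicut δ⁻(U):  ∅ ≠ U ⊆ T   or   T ⊆ U ⊊ V   (T = { v | inS v = false })
  isBicutSet : (inS : Fin n → Bool) → Vec Bool n → Bool
  isBicutSet inS U =
    (anyB (inU U) ∧ allB (λ v → not (inU U v) ∨ not (inS v)))
    ∨ (allB (λ v → inS v ∨ inU U v) ∧ anyB (λ v → not (inU U v)))

  theSystem : (inS : Fin n → Bool) → (b : Fin n → ℕ) → System m
  theSystem inS b =
    map (λ v → (if inS v then δ⁺ (singleton v) else δ⁻ (singleton v))
               , toℚ (ℤ.+ b v)) (allFin n)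
    ++ map (λ U → (δ⁻ U , 1ℚ)) (filterᵇ (isBicutSet inS) (allSubsets n))
    ++ map (λ a → (unitVec a 1ℚ , 0ℚ)) (allFin m)

module Submission where

open import Defs

-- Let x be a rational optimum for the integral cost c. Farkas' lemma (Fourier–Motzkin elimination) writes
-- M c, for some natural M > 0, as the sum of a multiset of rows that are tight at x. Crossing tight sets U, W
-- are not vertex sets, so both have cut value 1; hence U ∩ W and U ∪ W are tight as well, and the arcs between
-- U ∖ W and W ∖ U have x = 0. Uncrossing makes the tight subsets of T laminar, and likewise the complements
-- (inside S) of the tight sets containing T. Joining the two laminar trees at their roots, each arc enters the
-- sets on a directed path, so dividing the depths in the tree by M and rounding them down (total unimodularity
-- of network matrices) turns the multiset into an integral combination of tight rows equal to c. It is optimal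
-- by weak duality.

-- Integrality comes from one monotone map. In the joined tree an arc has a start and an end
-- position, read as signed depths: positive on the T side of the root, negative on the S side. The
-- number of cuts of the family that it enters is its end position minus its start position, and M c
-- is this difference plus a residue on single arcs. Replacing each position p by ⌊p / M⌋ preserves
-- the sign of the residue, since the floor is monotone and commutes with adding integers: i - j ≤ M
-- c gives ⌊i / M⌋ - ⌊j / M⌋ ≤ c, and likewise for ≥. Only this sign matters: a positive residue is
-- paid by a tight lower bound or nonnegativity row, a negative one by a tight upper bound. Hence
-- the box rows need no separate argument.
--
-- The rounded depths must again be the depths in some family. This holds for every function of the
-- depth that starts at 0 and climbs by 0 or 1 at a time: keep the sets at whose depth it climbs.
--
-- Arcs lost in uncrossing have x = 0, so their nonnegativity rows are tight and they join the
-- residue with positive sign.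

module Families where

  open import Data.Bool as Bool using (Bool; true; false; _∧_; _∨_; not; T)
  open import Data.Nat
  open import Data.Nat.Properties
  open import Data.Nat.ListAction using (sum)
  open import Data.Nat.ListAction.Properties using (sum-↭)
  open import Data.Nat.Tactic.RingSolver using (solve-∀)
  open import Data.Fin using (Fin)
  import Data.Fin.Properties as Fin
  open import Data.Fin.Subset using (Subset; _∩_; _∪_)
  open import Data.Vec using (lookup)
  open import Data.Vec.Properties using (lookup-zipWith)
  open import Data.List using (List; []; _∷_; map; cartesianProduct)
  open import Data.List.Relation.Unary.All as All using (All; []; _∷_)
  open import Data.List.Relation.Unary.All.Properties using (¬Any⇒All¬)
  open import Data.List.Relation.Unary.AllPairs as AllPairs using (AllPairs; []; _∷_)
  open import Data.List.Relation.Unary.Any as Any using (Any; here; there)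
  open import Data.List.Relation.Unary.Linked.Properties using (Linked⇒AllPairs)
  open import Data.List.Relation.Binary.Permutation.Propositional
  open import Data.List.Relation.Binary.Permutation.Propositional.Properties using (map⁺; All-resp-↭)
  import Data.List.Relation.Binary.Permutation.Setoid.Properties as Setoid-↭
  open import Data.List.Membership.Propositional using (_∈_)
  open import Data.List.Membership.Propositional.Properties using (∈-allFin; ∈-cartesianProduct⁺)
  open import Data.Product using (_×_; _,_; ∃; ∃₂)
  open import Data.Sum using (_⊎_; inj₁; inj₂)
  open import Data.Empty using (⊥-elim)
  open import Function using (_∘_)
  import Relation.Binary.Construct.On as On
  open import Relation.Binary.PropositionalEquality hiding (trans)
  import Relation.Binary.PropositionalEquality as ≡
  open import Relation.Nullary using (yes; no; ¬_; Dec)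
  open import Relation.Nullary.Decidable using (_×-dec_)

  -- Counting over lists, and Boolean identities by evaluation

  bit : Bool → ℕ
  bit false = 0
  bit true  = 1

  sumOf : ∀ {A : Set} → (A → ℕ) → List A → ℕ
  sumOf f L = sum (map f L)

  count : ∀ {A : Set} → (A → Bool) → List A → ℕ
  count p = sumOf (bit ∘ p)

  module _ {A : Set} where

    sumOf-↭ : ∀ (f : A → ℕ) {L L′} → L ↭ L′ → sumOf f L ≡ sumOf f L′
    sumOf-↭ f p = sum-↭ (map⁺ f p)

    sumOf-cong : ∀ {f g : A → ℕ} → (∀ x → f x ≡ g x) → ∀ L → sumOf f L ≡ sumOf g L
    sumOf-cong e []      = refl
    sumOf-cong e (x ∷ L) = cong₂ _+_ (e x) (sumOf-cong e L)

    sumOf-+ : ∀ (f g : A → ℕ) L → sumOf (λ x → f x + g x) L ≡ sumOf f L + sumOf g L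
    sumOf-+ f g []      = refl
    sumOf-+ f g (x ∷ L) = ≡.trans (cong (f x + g x +_) (sumOf-+ f g L)) (lemma (f x) (g x) _ _)
      where
      lemma : ∀ a b c d → a + b + (c + d) ≡ a + c + (b + d)
      lemma = solve-∀

    sumOf-mono-≤ : ∀ {f g : A → ℕ} → (∀ x → f x ≤ g x) → ∀ L → sumOf f L ≤ sumOf g L
    sumOf-mono-≤ h []      = z≤n
    sumOf-mono-≤ h (x ∷ L) = +-mono-≤ (h x) (sumOf-mono-≤ h L)

    sumOf-mono-< : ∀ {f g : A → ℕ} → (∀ x → f x ≤ g x) → ∀ {L x} → x ∈ L → f x < g x →
                   sumOf f L < sumOf g L
    sumOf-mono-< h {_ ∷ L} (here refl) f<g = +-mono-<-≤ f<g (sumOf-mono-≤ h L)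
    sumOf-mono-< h {y ∷ _} (there x∈)  f<g = +-mono-≤-< (h y) (sumOf-mono-< h x∈ f<g)

  every : (Bool → Bool) → Bool
  every p = p false ∧ p true

  every-sound : ∀ (p : Bool → Bool) → T (every p) → ∀ b → T (p b)
  every-sound p h false with p false | p true
  ... | true | true = _
  every-sound p h true with p false | p true
  ... | true | true = _

  -- The four Booleans will be the memberships of two vertices in two sets, so that uncrossing
  -- identities are settled by evaluating sixteen assignments.
  every₄-sound : ∀ (p : Bool → Bool → Bool → Bool → Bool) →
    T (every λ a → every λ b → every λ c → every λ d → p a b c d) → ∀ a b c d → T (p a b c d)
  every₄-sound p h a b c d =
    every-sound (λ d → p a b c d)
      (every-sound (λ c → every λ d → p a b c d)
        (every-sound (λ b → every λ c → every λ d → p a b c d)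
          (every-sound (λ a → every λ b → every λ c → every λ d → p a b c d) h a) b) c) d

  -- Uncrossing

  module _ {n : ℕ} where

    infix 4 _∋_ _∌_
    _∋_ _∌_ : Subset n → Fin n → Set
    U ∋ v = lookup U v ≡ true
    U ∌ v = lookup U v ≡ false

    -- All four regions are required because one definition serves both sides of the partition:
    -- subsets of T need a common vertex, complements of subsets of S a vertex outside both.
    Crossing : Subset n → Subset n → Set
    Crossing U W = (∃ λ v → U ∋ v × W ∌ v) × (∃ λ v → U ∌ v × W ∋ v) ×
                   (∃ λ v → U ∋ v × W ∋ v) × (∃ λ v → U ∌ v × W ∌ v)

    exists-with : ∀ U W a b → Dec (∃ λ (v : Fin n) → lookup U v ≡ a × lookup W v ≡ b)
    exists-with U W a b = Fin.any? λ v → (lookup U v Bool.≟ a) ×-dec (lookup W v Bool.≟ b)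

    crossing? : ∀ U W → Dec (Crossing U W)
    crossing? U W = exists-with U W true false ×-dec exists-with U W false true ×-dec
                    exists-with U W true true ×-dec exists-with U W false false

    lookup-∩ : ∀ (U W : Subset n) v → lookup (U ∩ W) v ≡ lookup U v ∧ lookup W v
    lookup-∩ U W v = lookup-zipWith _∧_ v U W

    lookup-∪ : ∀ (U W : Subset n) v → lookup (U ∪ W) v ≡ lookup U v ∨ lookup W v
    lookup-∪ U W v = lookup-zipWith _∨_ v U W

    separated : Subset n → Fin n × Fin n → ℕ
    separated U (v , w) = bit (lookup U v ∧ not (lookup U w))

    pairs : List (Fin n × Fin n)
    pairs = cartesianProduct (allFin n) (allFin n)

    -- |U| |V ∖ U|, which is strictly submodular on crossing pairs.
    weight : Subset n → ℕ
    weight U = sumOf (separated U) pairs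

    -- Pair by pair, the weak inequality is a truth table. It is strict at `(v , w)` with `v` in `U`
    -- only and `w` in `W` only: `U` separates this pair, but neither `U ∩ W` nor `U ∪ W` does.
    weight-uncross : ∀ {U W} → Crossing U W → weight (U ∩ W) + weight (U ∪ W) < weight U + weight W
    weight-uncross {U} {W} ((v , Uv , ¬Wv) , (w , ¬Uw , Ww) , _) = subst₂ _<_
      (sumOf-+ (separated (U ∩ W)) (separated (U ∪ W)) pairs) (sumOf-+ (separated U) (separated W) pairs)
      (sumOf-mono-< pointwise (∈-cartesianProduct⁺ (∈-allFin v) (∈-allFin w)) strict)
      where
      lhs : Bool → Bool → Bool → Bool → ℕ
      lhs a b c d = bit ((a ∧ b) ∧ not (c ∧ d)) + bit ((a ∨ b) ∧ not (c ∨ d))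
      rhs : Bool → Bool → Bool → Bool → ℕ
      rhs a b c d = bit (a ∧ not c) + bit (b ∧ not d)
      unfold-lhs : ∀ v w → separated (U ∩ W) (v , w) + separated (U ∪ W) (v , w)
                   ≡ lhs (lookup U v) (lookup W v) (lookup U w) (lookup W w)
      unfold-lhs v w rewrite lookup-∩ U W v | lookup-∩ U W w | lookup-∪ U W v | lookup-∪ U W w = refl
      pointwise : ∀ p → separated (U ∩ W) p + separated (U ∪ W) p ≤ separated U p + separated W p
      pointwise (v , w) = subst (_≤ separated U (v , w) + separated W (v , w)) (sym (unfold-lhs v w))
        (≤ᵇ⇒≤ _ _ (every₄-sound (λ a b c d → lhs a b c d ≤ᵇ rhs a b c d) _
          (lookup U v) (lookup W v) (lookup U w) (lookup W w)))
      strict : separated (U ∩ W) (v , w) + separated (U ∪ W) (v , w) < separated U (v , w) + separated W (v , w)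
      strict rewrite unfold-lhs v w | Uv | ¬Wv | ¬Uw | Ww = s≤s z≤n

    extract : ∀ {A : Set} {P : A → Set} {L} → Any P L → ∃₂ λ x L′ → P x × L ↭ x ∷ L′
    extract {L = x ∷ L} (here px) = x , L , px , refl
    extract {L = y ∷ L} (there p) with extract p
    ... | x , L′ , px , q = x , y ∷ L′ , px , trans (prep y q) (swap y x refl)

    find-crossing : ∀ F → AllPairs (λ U W → ¬ Crossing U W) F ⊎
                    (∃ λ U → ∃ λ W → ∃ λ F′ → Crossing U W × F ↭ U ∷ W ∷ F′)
    find-crossing [] = inj₁ []
    find-crossing (U ∷ F) with Any.any? (crossing? U) F | find-crossing F
    ... | yes c | _ = let W , F′ , UW , p = extract c in inj₂ (U , W , F′ , UW , prep U p)
    ... | no ¬c | inj₁ h = inj₁ (¬Any⇒All¬ F ¬c ∷ h)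
    ... | no ¬c | inj₂ (X , Y , F′ , XY , p) = inj₂ (X , Y , U ∷ F′ , XY ,
      trans (prep U p) (trans (swap U X refl) (prep X (swap U Y refl))))

    module _ {m : ℕ} (tail head : Fin m → Fin n) where

      enters : Fin m → Subset n → Bool
      enters a U = not (lookup U (tail a)) ∧ lookup U (head a)

      joins : Fin m → Subset n → Subset n → Bool
      joins a U W = (lookup U (tail a) ∧ not (lookup W (tail a)) ∧ not (lookup U (head a)) ∧ lookup W (head a))
                  ∨ (not (lookup U (tail a)) ∧ lookup W (tail a) ∧ lookup U (head a) ∧ not (lookup W (head a)))

      -- The arcs joining U ∖ W and W ∖ U, in either direction, are the exact defect in the
      -- submodularity of cuts.
      enters-uncross : ∀ U W a → bit (enters a U) + bit (enters a W) ≡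
                       bit (enters a (U ∩ W)) + bit (enters a (U ∪ W)) + bit (joins a U W)
      enters-uncross U W a
        rewrite lookup-∩ U W (tail a) | lookup-∩ U W (head a) | lookup-∪ U W (tail a) | lookup-∪ U W (head a)
        = ≡ᵇ⇒≡ _ _ (every₄-sound (λ a b c d →
            bit (not a ∧ c) + bit (not b ∧ d) ≡ᵇ
            bit (not (a ∧ b) ∧ (c ∧ d)) + bit (not (a ∨ b) ∧ (c ∨ d))
            + bit ((a ∧ not b ∧ not c ∧ d) ∨ (not a ∧ b ∧ c ∧ not d))) _
            (lookup U (tail a)) (lookup W (tail a)) (lookup U (head a)) (lookup W (head a)))

      module _ (K : Subset n → Set) (Null : Fin m → Set)
               (uncross : ∀ {U W} → K U → K W → Crossing U W →
                          K (U ∩ W) × K (U ∪ W) × (∀ a → joins a U W ≡ false ⊎ Null a)) where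

        -- `k` bounds the total weight, which drops with each uncrossing, so it can drive the
        -- recursion. `z` keeps account of the arcs that the uncrossings lose; being confined to
        -- `Null`, they can be repaid later.
        uncrossing : ∀ k F → sumOf weight F < k → All K F → ∃ λ F′ → ∃ λ (z : Fin m → ℕ) →
          All K F′ × AllPairs (λ U W → ¬ Crossing U W) F′ ×
          (∀ a → count (enters a) F ≡ count (enters a) F′ + z a) × (∀ a → z a ≡ 0 ⊎ Null a)
        uncrossing (suc k) F (s≤s w≤k) KF with find-crossing F
        ... | inj₁ h = F , (λ _ → 0) , KF , h , (λ a → sym (+-identityʳ _)) , λ a → inj₁ refl
        ... | inj₂ (U , W , G , UW , p) with All-resp-↭ p KF
        ... | KU ∷ KW ∷ KG with uncross KU KW UW
        ... | K∩ , K∪ , null with uncrossing k (U ∩ W ∷ U ∪ W ∷ G) smaller (K∩ ∷ K∪ ∷ KG)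
          where
          open ≤-Reasoning
          smaller : sumOf weight (U ∩ W ∷ U ∪ W ∷ G) < k
          smaller = begin-strict
            weight (U ∩ W) + (weight (U ∪ W) + sumOf weight G) ≡⟨ +-assoc (weight (U ∩ W)) _ _ ⟨
            weight (U ∩ W) + weight (U ∪ W) + sumOf weight G   <⟨ +-monoˡ-< _ (weight-uncross {U} {W} UW) ⟩
            weight U + weight W + sumOf weight G               ≡⟨ +-assoc (weight U) _ _ ⟩
            weight U + (weight W + sumOf weight G)             ≡⟨ sumOf-↭ weight p ⟨
            sumOf weight F                                     ≤⟨ w≤k ⟩
            k ∎
        ... | F′ , z , KF′ , h , e , nz = F′ , (λ a → z a + bit (joins a U W)) , KF′ , h , equation , null′
          where
          open ≡-Reasoning
          rearrange : ∀ p q j g → p + q + j + g ≡ p + (q + g) + j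
          rearrange = solve-∀
          equation : ∀ a → count (enters a) F ≡ count (enters a) F′ + (z a + bit (joins a U W))
          equation a = begin
            count (enters a) F ≡⟨ sumOf-↭ (bit ∘ enters a) p ⟩
            bit (enters a U) + (bit (enters a W) + count (enters a) G) ≡⟨ +-assoc (bit (enters a U)) _ _ ⟨
            bit (enters a U) + bit (enters a W) + count (enters a) G
              ≡⟨ cong (_+ count (enters a) G) (enters-uncross U W a) ⟩
            bit (enters a (U ∩ W)) + bit (enters a (U ∪ W)) + bit (joins a U W) + count (enters a) G
              ≡⟨ rearrange (bit (enters a (U ∩ W))) (bit (enters a (U ∪ W))) (bit (joins a U W)) _ ⟩
            count (enters a) (U ∩ W ∷ U ∪ W ∷ G) + bit (joins a U W)
              ≡⟨ cong (_+ bit (joins a U W)) (e a) ⟩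
            count (enters a) F′ + z a + bit (joins a U W)
              ≡⟨ +-assoc (count (enters a) F′) (z a) _ ⟩
            count (enters a) F′ + (z a + bit (joins a U W)) ∎
          null′ : ∀ a → z a + bit (joins a U W) ≡ 0 ⊎ Null a
          null′ a with nz a | null a
          ... | inj₂ n  | _       = inj₂ n
          ... | inj₁ _  | inj₂ n  = inj₂ n
          ... | inj₁ z₀ | inj₁ j₀ rewrite z₀ | j₀ = inj₁ refl

  -- Rounding a laminar family

  module Rounding {A : Set} {n : ℕ} (mem : A → Fin n → Bool) where

    Laminar : A → A → Set
    Laminar U W = (∀ v → mem U v ≡ true → mem W v ≡ true) ⊎
                  (∀ v → mem W v ≡ true → mem U v ≡ true) ⊎
                  (∀ v → mem U v ≡ true → mem W v ≡ false)

    Laminar-sym : ∀ {U W} → Laminar U W → Laminar W U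
    Laminar-sym (inj₁ h)        = inj₂ (inj₁ h)
    Laminar-sym (inj₂ (inj₁ h)) = inj₁ h
    Laminar-sym {U} {W} (inj₂ (inj₂ h)) = inj₂ (inj₂ disjoint)
      where
      disjoint : ∀ v → mem W v ≡ true → mem U v ≡ false
      disjoint v Wv with mem U v in Uv
      ... | false = refl
      ... | true with ≡.trans (sym Wv) (h v Uv)
      ...   | ()

    size : A → ℕ
    size U = count (mem U) (allFin n)

    Below : A → A → Set
    Below U W = (∀ v → mem U v ≡ true → mem W v ≡ true) ⊎ (∀ v → mem U v ≡ true → mem W v ≡ false)

    -- In the one unwanted case `W` lies inside `U`, and comparing sizes forces the two sets to have
    -- the same members.
    Laminar⇒Below : ∀ {U W} → Laminar U W → size U ≤ size W → Below U W
    Laminar⇒Below (inj₁ h)        _ = inj₁ h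
    Laminar⇒Below (inj₂ (inj₂ h)) _ = inj₂ h
    Laminar⇒Below {U} {W} (inj₂ (inj₁ h)) U≤W = inj₁ sub
      where
      bit-mono : ∀ v → bit (mem W v) ≤ bit (mem U v)
      bit-mono v with mem W v in Wv
      ... | false = z≤n
      ... | true rewrite h v Wv = ≤-refl
      sub : ∀ v → mem U v ≡ true → mem W v ≡ true
      sub v Uv with mem W v in Wv
      ... | true  = refl
      ... | false = ⊥-elim (<⇒≱ (sumOf-mono-< bit-mono (∈-allFin v) strict) U≤W)
        where
        strict : bit (mem W v) < bit (mem U v)
        strict rewrite Uv | Wv = ≤-refl

    -- Counted over a laminar family, this gives the depth of the lowest common ancestor of `s` and
    -- `t` in its tree; with `s` and `t` equal, the depth of a vertex.
    both : Fin n → Fin n → A → Bool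
    both s t U = mem U s ∧ mem U t

    -- Each set in `L` contains all of `U` or none of it, so every pair of vertices of `U` sees the
    -- same sets of `L`: the proper ancestors of `U`, counting equal sets later in the list among
    -- them.
    both-constant : ∀ {U L v s t} → All (Below U) L → mem U v ≡ true → mem U s ≡ true → mem U t ≡ true →
                    count (both s t) L ≡ count (both v v) L
    both-constant [] _ _ _ = refl
    both-constant {U} {W ∷ L} {v} {s} {t} (inj₁ h ∷ hs) Uv Us Ut
      rewrite h v Uv | h s Us | h t Ut = cong suc (both-constant hs Uv Us Ut)
    both-constant {U} {W ∷ L} {v} {s} {t} (inj₂ h ∷ hs) Uv Us Ut
      rewrite h v Uv | h s Us = both-constant hs Uv Us Ut

    module _ (E : ℕ → ℕ) (E-zero : E 0 ≡ 0) (E-suc : ∀ k → E (suc k) ≡ E k ⊎ E (suc k) ≡ suc (E k)) where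

      -- The k-th set counted inwards along a chain is selected iff E k = E (k - 1) + 1.
      round-sorted : ∀ {P : A → Set} L → AllPairs Below L → All (λ U → ∃ λ v → mem U v ≡ true) L → All P L →
                     ∃ λ L′ → All P L′ × (∀ s t → count (both s t) L′ ≡ E (count (both s t) L))
      round-sorted [] _ _ _ = [] , [] , λ s t → sym E-zero
      round-sorted (U ∷ L) (below ∷ bs) ((v , Uv) ∷ ne) (pU ∷ ps) with round-sorted L bs ne ps
      -- Any vertex of `U` measures the depth at which `U` is attached, by `both-constant`.
      ... | L′ , ps′ , h with E-suc (count (both v v) L)
      ... | inj₁ skip = L′ , ps′ , spec
        where
        spec : ∀ s t → count (both s t) L′ ≡ E (count (both s t) (U ∷ L))
        spec s t with mem U s in Us | mem U t in Ut
        ... | false | _     = h s t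
        ... | true  | false = h s t
        ... | true  | true  = ≡.trans (h s t)
          (subst (λ d → E d ≡ E (suc d)) (sym (both-constant below Uv Us Ut)) (sym skip))
      ... | inj₂ select = U ∷ L′ , pU ∷ ps′ , spec
        where
        spec : ∀ s t → count (both s t) (U ∷ L′) ≡ E (count (both s t) (U ∷ L))
        spec s t with mem U s in Us | mem U t in Ut
        ... | false | _     = h s t
        ... | true  | false = h s t
        ... | true  | true  = ≡.trans (cong suc (h s t))
          (subst (λ d → suc (E d) ≡ E (suc d)) (sym (both-constant below Uv Us Ut)) (sym select))

      open import Data.List.Sort (On.decTotalOrder ≤-decTotalOrder size) using (sort; sort-↭; sort-↗)

      -- Sorting by size puts each set before the larger ones, where laminarity becomes `Below`.
      -- Counts do not depend on the order.
      round-laminar : ∀ {P : A → Set} L → AllPairs Laminar L → All (λ U → ∃ λ v → mem U v ≡ true) L → All P L →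
                      ∃ λ L′ → All P L′ × (∀ s t → count (both s t) L′ ≡ E (count (both s t) L))
      round-laminar L lam ne ps with round-sorted (sort L)
        (AllPairs.zipWith (λ (l , s) → Laminar⇒Below l s)
          (Setoid-↭.AllPairs-resp-↭ (setoid A) Laminar-sym (resp₂ Laminar) (↭⇒↭ₛ sorted) lam , Linked⇒AllPairs ≤-trans (sort-↗ L)))
        (All-resp-↭ sorted ne) (All-resp-↭ sorted ps)
        where
        sorted : L ↭ sort L
        sorted = ↭-sym (sort-↭ L)
      ... | L′ , ps′ , h = L′ , ps′ , λ s t → ≡.trans (h s t) (cong E (sumOf-↭ (bit ∘ both s t) (sort-↭ L)))

  module Level (M r : ℕ) (r<M : r < M) where

    -- ⌊ (k + r) / M ⌋
    level : ℕ → ℕ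
    level zero = 0
    level (suc k) with M * suc (level k) ≤? suc k + r
    ... | yes _ = suc (level k)
    ... | no  _ = level k

    -- This is the property that `round-laminar` asks of `E`; it is immediate because `level` is
    -- defined by recursion and not by division.
    level-suc : ∀ k → level (suc k) ≡ level k ⊎ level (suc k) ≡ suc (level k)
    level-suc k with M * suc (level k) ≤? suc k + r
    ... | yes _ = inj₂ refl
    ... | no  _ = inj₁ refl

    level-lower : ∀ k → M * level k ≤ k + r
    level-lower zero = ≤-trans (≤-reflexive (*-zeroʳ M)) z≤n
    level-lower (suc k) with M * suc (level k) ≤? suc k + r
    ... | yes h = h
    ... | no  _ = m≤n⇒m≤1+n (level-lower k)

    level-upper : ∀ k → k + r < M * suc (level k)
    level-upper zero = <-≤-trans r<M (≤-reflexive (sym (*-identityʳ M)))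
    level-upper (suc k) with M * suc (level k) ≤? suc k + r
    ... | no  h = ≰⇒> h
    ... | yes _ = begin-strict
      suc k + r                   ≤⟨ level-upper k ⟩
      M * suc (level k)           <⟨ m<n+m _ (≤-<-trans z≤n r<M) ⟩
      M + M * suc (level k)       ≡⟨ *-suc M (suc (level k)) ⟨
      M * suc (suc (level k))     ∎
      where open ≤-Reasoning

-- Floors of signed depths

module RoundingArithmetic where

  open import Data.Nat as ℕ using (ℕ; suc)
  import Data.Nat.Properties as ℕ
  open import Data.Integer hiding (suc)
  open import Data.Integer.Properties
  open import Data.Integer.Tactic.RingSolver using (solve-∀)
  open import Data.Product using (_×_; _,_)
  open import Data.Sum using (_⊎_; inj₁; inj₂)
  open import Relation.Binary.PropositionalEquality

  open Families using (module Level)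

  module Floors (M-1 : ℕ) where

    M : ℕ
    M = suc M-1

    open Level M 0 (ℕ.s≤s ℕ.z≤n) public using () renaming
      (level to floor; level-suc to floor-suc; level-lower to floor-lower; level-upper to floor-upper)
    open Level M M-1 ℕ.≤-refl public using () renaming
      (level to ceil; level-suc to ceil-suc; level-lower to ceil-lower; level-upper to ceil-upper)

    -- `q` is ⌊i / M⌋, characterised by inequalities so that negative positions need no division.
    IsFloor : ℤ → ℤ → Set
    IsFloor i q = + M * q ≤ i × i < + M * (1ℤ + q)

    -- From i ≤ j + M c, monotonicity gives ⌊i / M⌋ ≤ ⌊j / M⌋ + c. This is the concrete form that
    -- total unimodularity of network matrices takes here.
    round-nonNeg : ∀ {i j p q} c → IsFloor i p → IsFloor j q →
                   0ℤ ≤ + M * c - (i - j) → 0ℤ ≤ c - (p - q)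
    round-nonNeg {i} {j} {p} {q} c (Mp≤i , _) (_ , j<) h =
      subst (0ℤ ≤_) (lemma₂ p q c) (i≤j⇒0≤j-i (i<j⇒suc[i]≤j (*-cancelˡ-<-nonNeg (+ M) (begin-strict
        + M * p                         ≤⟨ Mp≤i ⟩
        i                               ≤⟨ 0≤i-j⇒j≤i (subst (0ℤ ≤_) (lemma₀ i j (+ M) c) h) ⟩
        j + + M * c                     <⟨ +-monoˡ-< (+ M * c) j< ⟩
        + M * (1ℤ + q) + + M * c        ≡⟨ lemma₁ (+ M) q c ⟩
        + M * (1ℤ + (q + c))            ∎))))
      where
      open ≤-Reasoning
      lemma₀ : ∀ i j m c → m * c - (i - j) ≡ j + m * c - i
      lemma₀ = solve-∀
      lemma₁ : ∀ m q c → m * (1ℤ + q) + m * c ≡ m * (1ℤ + (q + c))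
      lemma₁ = solve-∀
      lemma₂ : ∀ p q c → 1ℤ + (q + c) - (1ℤ + p) ≡ c - (p - q)
      lemma₂ = solve-∀

    round-nonPos : ∀ {i j p q} c → IsFloor i p → IsFloor j q →
                   + M * c - (i - j) ≤ 0ℤ → c - (p - q) ≤ 0ℤ
    round-nonPos {i} {j} {p} {q} c fi fj h = neg-cancel-≤ (subst (0ℤ ≤_) (lemma₂ p q c)
      (round-nonNeg (- c) fj fi (subst (0ℤ ≤_) (lemma₁ i j (+ M) c) (neg-mono-≤ h))))
      where
      lemma₁ : ∀ i j m c → - (m * c - (i - j)) ≡ m * - c - (j - i)
      lemma₁ = solve-∀
      lemma₂ : ∀ p q c → - c - (q - p) ≡ - (c - (p - q))
      lemma₂ = solve-∀

    floor-IsFloor : ∀ k → IsFloor (+ k) (+ floor k)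
    floor-IsFloor k =
      subst (_≤ + k) (pos-* M (floor k)) (+≤+ (subst (M ℕ.* floor k ℕ.≤_) (ℕ.+-identityʳ k) (floor-lower k))) ,
      subst (+ k <_) (pos-* M (suc (floor k))) (+<+ (subst (ℕ._< M ℕ.* suc (floor k)) (ℕ.+-identityʳ k) (floor-upper k)))

    -- Depths on the S side count negatively, so rounding positions down means rounding these depths
    -- up.
    ceil-IsFloor : ∀ k → IsFloor (- (+ k)) (- (+ ceil k))
    ceil-IsFloor k = subst (_≤ - (+ k)) (lemma₁ (+ M) (+ ceil k)) (neg-mono-≤ k≤) ,
      subst₂ _<_ (lemma₂ (+ k) (+ M)) (lemma₃ (+ M) (+ ceil k)) (+-monoˡ-< (+ M) (neg-mono-< <k+M))
      where
      k≤ : + k ≤ + M * + ceil k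
      k≤ = subst (+ k ≤_) (pos-* M (ceil k)) (+≤+ (ℕ.+-cancelʳ-≤ M-1 k (M ℕ.* ceil k) (ℕ.≤-pred
             (subst (suc (k ℕ.+ M-1) ℕ.≤_) (trans (ℕ.*-suc M (ceil k)) (cong suc (ℕ.+-comm M-1 _))) (ceil-upper k)))))
      <k+M : + M * + ceil k < + k + + M
      <k+M = subst₂ _<_ (pos-* M (ceil k)) (pos-+ k M)
               (+<+ (ℕ.≤-<-trans (ceil-lower k) (ℕ.+-monoʳ-< k ℕ.≤-refl)))
      lemma₁ : ∀ m c → - (m * c) ≡ m * - c
      lemma₁ = solve-∀
      lemma₂ : ∀ k m → - (k + m) + m ≡ - k
      lemma₂ = solve-∀
      lemma₃ : ∀ m c → - (m * c) + m ≡ m * (1ℤ + - c)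
      lemma₃ = solve-∀

    -- One depth has to vanish: for k = l = 1 and M = 2 the floor of the difference is 0, whereas ⌊1
    -- / 2⌋ - ⌈1 / 2⌉ is -1.
    floor-ceil-IsFloor : ∀ k l → k ≡ 0 ⊎ l ≡ 0 → IsFloor (+ k - + l) (+ floor k - + ceil l)
    floor-ceil-IsFloor .0 l (inj₁ refl) =
      subst₂ IsFloor (sym (+-identityˡ _)) (sym (+-identityˡ _)) (ceil-IsFloor l)
    floor-ceil-IsFloor k .0 (inj₂ refl) =
      subst₂ IsFloor (sym (+-identityʳ _)) (sym (+-identityʳ _)) (floor-IsFloor k)

module DualSolutions where

  open import Data.Bool using (Bool; true; false; _∧_; _∨_; _xor_; not; if_then_else_)
  open import Data.Bool.Properties using (∨-zeroʳ; ∧-zeroʳ; T-≡; not-involutive; ¬-not)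
  open import Data.Nat as ℕ using (ℕ; zero; suc)
  import Data.Nat.Properties as ℕ
  open import Data.Integer as ℤ using (ℤ)
  import Data.Integer.Properties as ℤ
  open import Data.Integer.Tactic.RingSolver renaming (solve-∀ to ℤ-solve-∀)
  open import Data.Rational using (ℚ; mkℚ; toℚᵘ; _+_; _*_; -_; _-_; _≤_; _<_; 0ℚ; 1ℚ; 1/_; _⊔_; _⊓_; positive; nonNegative)
  open import Data.Rational.Properties as ℚ hiding (_≟_)
  import Data.Rational.Unnormalised as ℚᵘ
  import Data.Rational.Unnormalised.Properties as ℚᵘ
  open import Data.Fin using (Fin; zero; suc; _≟_)
  open import Data.Fin.Subset using (Subset; _∩_; _∪_)
  open import Data.Vec as Vec using (Vec; []; _∷_; lookup)
  open import Data.Vec.Properties using (lookup∘tabulate; lookup-map)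
  open import Data.Vec.Functional using () renaming (_∷_ to _◂_)
  open import Data.List as List using (List; []; _∷_; _++_; map; concat; replicate; filterᵇ; cartesianProductWith)
  open import Data.List.Relation.Unary.All as All using (All; []; _∷_)
  import Data.List.Relation.Unary.All.Properties as All
  open import Data.List.Relation.Unary.AllPairs using (AllPairs; []; _∷_)
  open import Data.List.Relation.Unary.Any as Any using (here; there)
  open import Data.List.Relation.Unary.Any.Properties using (lookup-index)
  open import Data.List.Membership.Propositional using (_∈_)
  open import Data.List.Membership.Propositional.Properties
    using (∈-++⁺ˡ; ∈-++⁺ʳ; ∈-++⁻; ∈-map⁺; ∈-map⁻; ∈-filter⁺; ∈-filter⁻; ∈-concatMap⁺; ∈-allFin; ∈-lookup;
           ∈-cartesianProductWith⁺; ∈-cartesianProductWith⁻)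
  open import Data.Product using (_×_; _,_; proj₁; proj₂; ∃; ∃₂)
  open import Data.Sum as Sum using (_⊎_; inj₁; inj₂; [_,_]′)
  open import Data.Empty using (⊥; ⊥-elim)
  open import Function using (_∘_; Equivalence)
  open import Level using (0ℓ)
  open import Relation.Binary.Definitions using (tri<; tri≈; tri>)
  open import Relation.Binary.PropositionalEquality
  open import Relation.Nullary using (yes; no; ¬_)
  open import Relation.Nullary.Decidable using (⌊_⌋; T?; dec⇒maybe)
  open import Tactic.RingSolver using (solve-∀)
  open import Tactic.RingSolver.Core.AlmostCommutativeRing using (AlmostCommutativeRing; fromCommutativeRing)
  open Families
  open RoundingArithmetic

  ℚ-ring : AlmostCommutativeRing 0ℓ 0ℓ
  ℚ-ring = fromCommutativeRing +-*-commutativeRing (λ p → dec⇒maybe (0ℚ ℚ.≟ p))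

  -- Rational arithmetic

  *-cancelˡ-≤ : ∀ {q p r : ℚ} → 0ℚ < q → q * p ≤ q * r → p ≤ r
  *-cancelˡ-≤ {q} 0<q = *-cancelˡ-≤-pos q {{positive 0<q}}

  *-monoˡ-≤ : ∀ {q p r : ℚ} → 0ℚ ≤ q → p ≤ r → q * p ≤ q * r
  *-monoˡ-≤ {q} 0≤q = *-monoˡ-≤-nonNeg q {{nonNegative 0≤q}}

  *-nonNeg : ∀ {p q} → 0ℚ ≤ p → 0ℚ ≤ q → 0ℚ ≤ p * q
  *-nonNeg {p} {q} 0≤p 0≤q = ≤-trans (≤-reflexive (sym (*-zeroʳ p))) (*-monoˡ-≤ 0≤p 0≤q)

  +-nonNeg : ∀ {p q} → 0ℚ ≤ p → 0ℚ ≤ q → 0ℚ ≤ p + q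
  +-nonNeg 0≤p 0≤q = ≤-trans (≤-reflexive (sym (+-identityˡ 0ℚ))) (+-mono-≤ 0≤p 0≤q)

  p≤q⇒0≤q-p : ∀ {p q : ℚ} → p ≤ q → 0ℚ ≤ q - p
  p≤q⇒0≤q-p {p} p≤q = ≤-trans (≤-reflexive (sym (+-inverseʳ p))) (+-monoˡ-≤ (- p) p≤q)

  +-cancelʳ : ∀ p r → p + r - r ≡ p
  +-cancelʳ p r = trans (+-assoc p r (- r)) (trans (cong (p +_) (+-inverseʳ r)) (+-identityʳ p))

  p+r≤q+r⇒p≤q : ∀ {p q} r → p + r ≤ q + r → p ≤ q
  p+r≤q+r⇒p≤q {p} {q} r h = subst₂ _≤_ (+-cancelʳ p r) (+-cancelʳ q r) (+-monoˡ-≤ (- r) h)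

  nonNeg-sum-0 : ∀ {p q} → 0ℚ ≤ p → 0ℚ ≤ q → p + q ≡ 0ℚ → p ≡ 0ℚ × q ≡ 0ℚ
  nonNeg-sum-0 {p} {q} 0≤p 0≤q e =
    ≤-antisym (subst₂ _≤_ (+-identityʳ p) e (+-monoʳ-≤ p 0≤q)) 0≤p ,
    ≤-antisym (subst₂ _≤_ (+-identityˡ q) e (+-monoˡ-≤ q 0≤p)) 0≤q

  inverse-pos : ∀ {p} → 0ℚ < p → ∃ λ q → 0ℚ < q × q * p ≡ 1ℚ
  inverse-pos {p} 0<p =
    (1/ p) {{nz}} , positive⁻¹ ((1/ p) {{nz}}) {{1/pos⇒pos p {{positive 0<p}}}} , *-inverseˡ p {{nz}}
    where nz = pos⇒nonZero p {{positive 0<p}}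

  0<1 : 0ℚ < 1ℚ
  0<1 = positive⁻¹ 1ℚ

  toℚᵘ-toℚ : ∀ z → toℚᵘ (toℚ z) ℚᵘ.≃ ℚᵘ.mkℚᵘ z 0
  toℚᵘ-toℚ z = toℚᵘ-fromℚᵘ (ℚᵘ.mkℚᵘ z 0)

  toℚ-+ : ∀ y z → toℚ (y ℤ.+ z) ≡ toℚ y + toℚ z
  toℚ-+ y z = toℚᵘ-injective (begin
    toℚᵘ (toℚ (y ℤ.+ z))        ≈⟨ toℚᵘ-toℚ (y ℤ.+ z) ⟩
    ℚᵘ.mkℚᵘ (y ℤ.+ z) 0                       ≈⟨ ℚᵘ.*≡* (lemma y z) ⟩
    ℚᵘ.mkℚᵘ y 0 ℚᵘ.+ ℚᵘ.mkℚᵘ z 0             ≈⟨ ℚᵘ.+-cong (toℚᵘ-toℚ y) (toℚᵘ-toℚ z) ⟨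
    toℚᵘ (toℚ y) ℚᵘ.+ toℚᵘ (toℚ z) ≈⟨ toℚᵘ-homo-+ (toℚ y) (toℚ z) ⟨
    toℚᵘ (toℚ y + toℚ z) ∎)
    where
    open ℚᵘ.≃-Reasoning
    lemma : ∀ y z → (y ℤ.+ z) ℤ.* (ℤ.+ 1) ≡ (y ℤ.* (ℤ.+ 1) ℤ.+ z ℤ.* (ℤ.+ 1)) ℤ.* (ℤ.+ 1)
    lemma = ℤ-solve-∀

  toℚ-* : ∀ y z → toℚ (y ℤ.* z) ≡ toℚ y * toℚ z
  toℚ-* y z = toℚᵘ-injective (begin
    toℚᵘ (toℚ (y ℤ.* z))        ≈⟨ toℚᵘ-toℚ (y ℤ.* z) ⟩
    ℚᵘ.mkℚᵘ y 0 ℚᵘ.* ℚᵘ.mkℚᵘ z 0             ≈⟨ ℚᵘ.*-cong (toℚᵘ-toℚ y) (toℚᵘ-toℚ z) ⟨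
    toℚᵘ (toℚ y) ℚᵘ.* toℚᵘ (toℚ z) ≈⟨ toℚᵘ-homo-* (toℚ y) (toℚ z) ⟨
    toℚᵘ (toℚ y * toℚ z) ∎)
    where open ℚᵘ.≃-Reasoning

  toℚ-mono-≤ : ∀ {y z} → y ℤ.≤ z → toℚ y ≤ toℚ z
  toℚ-mono-≤ {y} {z} y≤z = toℚᵘ-cancel-≤
    (ℚᵘ.≤-respˡ-≃ (ℚᵘ.≃-sym (toℚᵘ-toℚ y)) (ℚᵘ.≤-respʳ-≃ (ℚᵘ.≃-sym (toℚᵘ-toℚ z))
      (ℚᵘ.*≤* (ℤ.*-monoʳ-≤-nonNeg (ℤ.+ 1) y≤z))))

  toℚ-injective : ∀ {y z} → toℚ y ≡ toℚ z → y ≡ z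
  toℚ-injective {y} {z} e with ℚᵘ.≃-trans (ℚᵘ.≃-sym (toℚᵘ-toℚ y)) (ℚᵘ.≃-trans (ℚᵘ.≃-reflexive (cong toℚᵘ e)) (toℚᵘ-toℚ z))
  ... | ℚᵘ.*≡* e′ = ℤ.*-cancelʳ-≡ y z (ℤ.+ 1) e′

  opaque
    ⟦_⟧ : ℕ → ℚ
    ⟦ k ⟧ = toℚ (ℤ.+ k)

    ⟦⟧-toℚ : ∀ k → ⟦ k ⟧ ≡ toℚ (ℤ.+ k)
    ⟦⟧-toℚ k = refl

  ⟦0⟧ : ⟦ 0 ⟧ ≡ 0ℚ
  ⟦0⟧ = ⟦⟧-toℚ 0

  ⟦1⟧ : ⟦ 1 ⟧ ≡ 1ℚ
  ⟦1⟧ = ⟦⟧-toℚ 1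

  opaque
    unfolding ⟦_⟧

    ⟦⟧-+ : ∀ j k → ⟦ j ℕ.+ k ⟧ ≡ ⟦ j ⟧ + ⟦ k ⟧
    ⟦⟧-+ j k = toℚ-+ (ℤ.+ j) (ℤ.+ k)

    ⟦⟧-* : ∀ j k → ⟦ j ℕ.* k ⟧ ≡ ⟦ j ⟧ * ⟦ k ⟧
    ⟦⟧-* j k = trans (cong toℚ (ℤ.pos-* j k)) (toℚ-* (ℤ.+ j) (ℤ.+ k))

    ⟦⟧-pos : ∀ {k} → k ≢ 0 → 0ℚ < ⟦ k ⟧
    ⟦⟧-pos {zero}  k≢0 = ⊥-elim (k≢0 refl)
    ⟦⟧-pos {suc k} _   = <-≤-trans 0<1 (toℚ-mono-≤ {ℤ.+ 1} {ℤ.+ suc k} (ℤ.+≤+ (ℕ.s≤s ℕ.z≤n)))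

    -- Lets a rational scaling be traded for natural multiplicities once denominators are cleared.
    numden : ∀ {q} → 0ℚ < q → ∃₂ λ p r → r ≢ 0 × ⟦ r ⟧ * q ≡ ⟦ p ⟧
    numden {mkℚ (ℤ.+ p) r c} _ = p , suc r , (λ ()) , toℚᵘ-injective (begin
      toℚᵘ (⟦ suc r ⟧ * q) ≈⟨ toℚᵘ-homo-* ⟦ suc r ⟧ q ⟩
      toℚᵘ ⟦ suc r ⟧ ℚᵘ.* ℚᵘ.mkℚᵘ (ℤ.+ p) r ≈⟨ ℚᵘ.*-congʳ {ℚᵘ.mkℚᵘ (ℤ.+ p) r} (toℚᵘ-toℚ (ℤ.+ suc r)) ⟩
      ℚᵘ.mkℚᵘ (ℤ.+ suc r) 0 ℚᵘ.* ℚᵘ.mkℚᵘ (ℤ.+ p) r ≈⟨ ℚᵘ.*≡* (lemma (ℤ.+ suc r) (ℤ.+ p)) ⟩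
      ℚᵘ.mkℚᵘ (ℤ.+ p) 0 ≈⟨ toℚᵘ-toℚ (ℤ.+ p) ⟨
      toℚᵘ ⟦ p ⟧ ∎)
      where
      open ℚᵘ.≃-Reasoning
      q : ℚ
      q = mkℚ (ℤ.+ p) r c
      lemma : ∀ s p → s ℤ.* p ℤ.* (ℤ.+ 1) ≡ p ℤ.* (ℤ.+ 1 ℤ.* s)
      lemma = ℤ-solve-∀
    numden {mkℚ (ℤ.-[1+ p ]) r c} 0<q = ⊥-elim (≤⇒≯ (nonPositive⁻¹ (mkℚ ℤ.-[1+ p ] r c)) 0<q)
      where
      ≤⇒≯ : ∀ {p q : ℚ} → p ≤ q → ¬ q < p
      ≤⇒≯ p≤q q<p = <-irrefl refl (<-≤-trans q<p p≤q)

  -- Sums and scalar products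

  ∑-cong : ∀ {k} {f g : Fin k → ℚ} → (∀ i → f i ≡ g i) → ∑ f ≡ ∑ g
  ∑-cong {zero}  e = refl
  ∑-cong {suc k} e = cong₂ _+_ (e zero) (∑-cong (e ∘ suc))

  ∑-+ : ∀ {k} (f g : Fin k → ℚ) → ∑ (λ i → f i + g i) ≡ ∑ f + ∑ g
  ∑-+ {zero}  f g = refl
  ∑-+ {suc k} f g = trans (cong ((f zero + g zero) +_) (∑-+ (f ∘ suc) (g ∘ suc)))
                          (interchange (f zero) (g zero) (∑ (f ∘ suc)) (∑ (g ∘ suc)))
    where
    interchange : ∀ a b c d → a + b + (c + d) ≡ a + c + (b + d)
    interchange = solve-∀ ℚ-ring

  ∑-*ˡ : ∀ {k} q (f : Fin k → ℚ) → ∑ (λ i → q * f i) ≡ q * ∑ f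
  ∑-*ˡ {zero}  q f = sym (*-zeroʳ q)
  ∑-*ˡ {suc k} q f = trans (cong (q * f zero +_) (∑-*ˡ q (f ∘ suc))) (sym (*-distribˡ-+ q _ _))

  ∑-zero : ∀ {k} {f : Fin k → ℚ} → (∀ i → f i ≡ 0ℚ) → ∑ f ≡ 0ℚ
  ∑-zero {zero}  e = refl
  ∑-zero {suc k} e = trans (cong₂ _+_ (e zero) (∑-zero (e ∘ suc))) (+-identityˡ 0ℚ)

  ∑-mono-≤ : ∀ {k} {f g : Fin k → ℚ} → (∀ i → f i ≤ g i) → ∑ f ≤ ∑ g
  ∑-mono-≤ {zero}  h = ≤-refl
  ∑-mono-≤ {suc k} h = +-mono-≤ (h zero) (∑-mono-≤ (h ∘ suc))

  ∑-nonNeg : ∀ {k} {f : Fin k → ℚ} → (∀ i → 0ℚ ≤ f i) → 0ℚ ≤ ∑ f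
  ∑-nonNeg {k} h = ≤-trans (≤-reflexive (sym (∑-zero {k} {λ _ → 0ℚ} (λ _ → refl)))) (∑-mono-≤ h)

  ∑-nonNeg-0 : ∀ {k} {f : Fin k → ℚ} → (∀ i → 0ℚ ≤ f i) → ∑ f ≡ 0ℚ → ∀ i → f i ≡ 0ℚ
  ∑-nonNeg-0 {suc k} h e i with nonNeg-sum-0 (h zero) (∑-nonNeg (h ∘ suc)) e
  ∑-nonNeg-0 {suc k} h e zero    | e₀ , _  = e₀
  ∑-nonNeg-0 {suc k} h e (suc i) | _  , e₁ = ∑-nonNeg-0 (h ∘ suc) e₁ i

  ∑-swap : ∀ {j k} (f : Fin j → Fin k → ℚ) → ∑ (λ i → ∑ (f i)) ≡ ∑ (λ i′ → ∑ (λ i → f i i′))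
  ∑-swap {zero}  {k} f = sym (∑-zero {k} (λ _ → refl))
  ∑-swap {suc j} f = trans (cong (∑ (f zero) +_) (∑-swap (f ∘ suc))) (sym (∑-+ (f zero) _))

  dot-cong : ∀ {m} {α α′ : Fin m → ℚ} x → (∀ a → α a ≡ α′ a) → dot α x ≡ dot α′ x
  dot-cong x e = ∑-cong (λ a → cong (_* x a) (e a))

  dot-+ˡ : ∀ {m} (α α′ x : Fin m → ℚ) → dot (λ a → α a + α′ a) x ≡ dot α x + dot α′ x
  dot-+ˡ α α′ x = trans (∑-cong (λ a → *-distribʳ-+ (x a) (α a) (α′ a))) (∑-+ (λ a → α a * x a) _)

  dot-*ˡ : ∀ {m} q (α x : Fin m → ℚ) → dot (λ a → q * α a) x ≡ q * dot α x
  dot-*ˡ q α x = trans (∑-cong (λ a → *-assoc q (α a) (x a))) (∑-*ˡ q (λ a → α a * x a))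

  dot-zeroˡ : ∀ {m} (x : Fin m → ℚ) → dot (λ _ → 0ℚ) x ≡ 0ℚ
  dot-zeroˡ x = ∑-zero (λ a → *-zeroˡ (x a))

  dot-step : ∀ {m} (α x d : Fin m → ℚ) q → dot α (λ a → x a + q * d a) ≡ dot α x + q * dot α d
  dot-step α x d q = trans (∑-cong (λ a → lemma (α a) (x a) (d a) q))
                           (trans (∑-+ (λ a → α a * x a) _) (cong (dot α x +_) (∑-*ˡ q (λ a → α a * d a))))
    where
    lemma : ∀ α x d q → α * (x + q * d) ≡ α * x + q * (α * d)
    lemma = solve-∀ ℚ-ring

  -- Fourier–Motzkin elimination

  -- Positive combinations of rows, kept as derivations so that a certificate can be analysed by
  -- recursion. Each constructor carries equations because coefficient functions are compared only
  -- pointwise.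
  data Cone {m} (G : Row m → Set) : (Fin m → ℚ) → ℚ → Set where
    gen   : ∀ {r v γ} → G r → (∀ a → v a ≡ proj₁ r a) → γ ≡ proj₂ r → Cone G v γ
    add   : ∀ {v′ v″ γ′ γ″ v γ} → Cone G v′ γ′ → Cone G v″ γ″ →
            (∀ a → v a ≡ v′ a + v″ a) → γ ≡ γ′ + γ″ → Cone G v γ
    scale : ∀ {q v′ γ′ v γ} → 0ℚ < q → Cone G v′ γ′ →
            (∀ a → v a ≡ q * v′ a) → γ ≡ q * γ′ → Cone G v γ

  -- Pulls a certificate back through one elimination step: each eliminated row is replaced by its
  -- derivation, in which the eliminated variable has coefficient 0.
  Cone-bind : ∀ {m} {G : Row m → Set} {H : Row (suc m) → Set} →
              (∀ {r} → G r → Cone H (0ℚ ◂ proj₁ r) (proj₂ r)) →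
              ∀ {v γ} → Cone G v γ → Cone H (0ℚ ◂ v) γ
  Cone-bind f (gen {r} {v} g e e′) =
    scale 0<1 (f g) (λ { zero → refl ; (suc a) → trans (e a) (sym (*-identityˡ _)) })
      (trans e′ (sym (*-identityˡ _)))
  Cone-bind f (add p q e e′) =
    add (Cone-bind f p) (Cone-bind f q) (λ { zero → sym (+-identityˡ 0ℚ) ; (suc a) → e a }) e′
  Cone-bind f (scale {q} 0<q p e e′) =
    scale 0<q (Cone-bind f p) (λ { zero → sym (*-zeroʳ q) ; (suc a) → e a }) e′

  Sat : ∀ {m} → (Fin m → ℚ) → Row m → Set
  Sat x r = proj₂ r ≤ dot (proj₁ r) x

  normalise : ∀ {m} → ℚ → Row (suc m) → Row m
  normalise q (α , β) = (λ a → q * α (suc a)) , q * β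

  Cone-normalise : ∀ {m} {G : Row (suc m) → Set} {r σ q} → 0ℚ < q → q * proj₁ r zero ≡ σ → G r →
                   Cone G (σ ◂ proj₁ (normalise q r)) (proj₂ (normalise q r))
  Cone-normalise 0<q e g =
    scale 0<q (gen g (λ _ → refl) refl) (λ { zero → sym e ; (suc a) → refl }) refl

  Sat-normalise : ∀ {m} (r : Row (suc m)) {σ q} t x → 0ℚ < q → q * proj₁ r zero ≡ σ →
                  Sat (t ◂ x) (σ ◂ proj₁ (normalise q r) , proj₂ (normalise q r)) → Sat (t ◂ x) r
  Sat-normalise r@(α , β) {σ} {q} t x 0<q e h = *-cancelˡ-≤ 0<q (≤-trans h (≤-reflexive (begin
    σ * t + dot (λ a → q * α (suc a)) x   ≡⟨ cong₂ (λ τ d → τ * t + d) (sym e) (dot-*ˡ q (α ∘ suc) x) ⟩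
    q * α zero * t + q * dot (α ∘ suc) x  ≡⟨ lemma q (α zero) t (dot (α ∘ suc) x) ⟩
    q * dot α (t ◂ x)                     ∎)))
    where
    open ≡-Reasoning
    lemma : ∀ q α₀ t d → q * α₀ * t + q * d ≡ q * (α₀ * t + d)
    lemma = solve-∀ ℚ-ring

  -- The rows grouped by the sign of the coefficient of the first variable t, normalised to 1, -1 and 0.
  record Split {m} (rows : List (Row (suc m))) : Set where
    field
      lower upper free : List (Row m)
      lower-cone : All (λ r → Cone (_∈ rows) (1ℚ ◂ proj₁ r) (proj₂ r)) lower
      upper-cone : All (λ r → Cone (_∈ rows) (- 1ℚ ◂ proj₁ r) (proj₂ r)) upper
      free-cone  : All (λ r → Cone (_∈ rows) (0ℚ ◂ proj₁ r) (proj₂ r)) free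
      complete   : ∀ t x → All (λ r → Sat (t ◂ x) (1ℚ ◂ proj₁ r , proj₂ r)) lower →
                   All (λ r → Sat (t ◂ x) (- 1ℚ ◂ proj₁ r , proj₂ r)) upper →
                   All (λ r → Sat (t ◂ x) (0ℚ ◂ proj₁ r , proj₂ r)) free →
                   Feasible rows (t ◂ x)

  Cone-mono : ∀ {m} {G H : Row m → Set} → (∀ {r} → G r → H r) → ∀ {v γ} → Cone G v γ → Cone H v γ
  Cone-mono f (gen g e e′)       = gen (f g) e e′
  Cone-mono f (add p q e e′)     = add (Cone-mono f p) (Cone-mono f q) e e′
  Cone-mono f (scale 0<q p e e′) = scale 0<q (Cone-mono f p) e e′

  split : ∀ {m} (rows : List (Row (suc m))) → Split rows
  split [] = record
    { lower = [] ; upper = [] ; free = [] ; lower-cone = [] ; upper-cone = [] ; free-cone = []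
    ; complete = λ _ _ _ _ _ → [] }
  split (r ∷ rows) with split rows | <-cmp 0ℚ (proj₁ r zero)
  ... | s | tri< 0<r₀ _ _ = let q , 0<q , e = inverse-pos 0<r₀ in record
    { lower = normalise q r ∷ lower ; upper = upper ; free = free
    ; lower-cone = Cone-normalise 0<q e (here refl) ∷ All.map (Cone-mono there) lower-cone
    ; upper-cone = All.map (Cone-mono there) upper-cone
    ; free-cone  = All.map (Cone-mono there) free-cone
    ; complete   = λ { t x (h ∷ hs) hu hf → Sat-normalise r t x 0<q e h ∷ complete t x hs hu hf } }
    where open Split s
  ... | s | tri≈ _ 0≡r₀ _ = record
    { lower = lower ; upper = upper ; free = normalise 1ℚ r ∷ free
    ; lower-cone = All.map (Cone-mono there) lower-cone
    ; upper-cone = All.map (Cone-mono there) upper-cone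
    ; free-cone  = Cone-normalise 0<1 e (here refl) ∷ All.map (Cone-mono there) free-cone
    ; complete   = λ { t x hl hu (h ∷ hs) → Sat-normalise r t x 0<1 e h ∷ complete t x hl hu hs } }
    where
    open Split s
    e : 1ℚ * proj₁ r zero ≡ 0ℚ
    e = trans (*-identityˡ _) (sym 0≡r₀)
  ... | s | tri> _ _ r₀<0 = let q , 0<q , e = inverse-pos (neg-antimono-< r₀<0)
                                e′ = trans (lemma q (proj₁ r zero)) (cong -_ e) in record
    { lower = lower ; upper = normalise q r ∷ upper ; free = free
    ; lower-cone = All.map (Cone-mono there) lower-cone
    ; upper-cone = Cone-normalise 0<q e′ (here refl) ∷ All.map (Cone-mono there) upper-cone
    ; free-cone  = All.map (Cone-mono there) free-cone
    ; complete   = λ { t x hl (h ∷ hs) hf → Sat-normalise r t x 0<q e′ h ∷ complete t x hl hs hf } }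
    where
    open Split s
    lemma : ∀ q r → q * r ≡ - (q * - r)
    lemma = solve-∀ ℚ-ring

  lower-bound : (us : List ℚ) → ∃ λ t → All (t ≤_) us
  lower-bound [] = 0ℚ , []
  lower-bound (u ∷ us) = let t , h = lower-bound us in
    u ⊓ t , p⊓q≤p u t ∷ All.map (≤-trans (p⊓q≤q u t)) h

  -- The maximum of the lower bounds works, since each of them is below every upper bound;
  -- `lower-bound` supplies a start when there are none.
  between : (ls us : List ℚ) → All (λ l → All (l ≤_) us) ls → ∃ λ t → All (_≤ t) ls × All (t ≤_) us
  between [] us [] = let t , h = lower-bound us in t , [] , h
  between (l ∷ ls) us (h ∷ hs) = let t , hl , hu = between ls us hs in
    l ⊔ t , p≤p⊔q l t ∷ All.map (λ p → ≤-trans p (p≤q⊔p l t)) hl ,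
    All.map (λ (p , q) → ⊔-lub p q) (All.zip (h , hu))

  _⊕_ : ∀ {m} → Row m → Row m → Row m
  (α , β) ⊕ (α′ , β′) = (λ a → α a + α′ a) , β + β′

  eliminate : ∀ {m} {rows : List (Row (suc m))} → Split rows → List (Row m)
  eliminate s = free ++ cartesianProductWith _⊕_ lower upper
    where open Split s

  eliminate-cone : ∀ {m} {rows : List (Row (suc m))} (s : Split rows) {r} → r ∈ eliminate s →
                   Cone (_∈ rows) (0ℚ ◂ proj₁ r) (proj₂ r)
  eliminate-cone s r∈ with ∈-++⁻ (Split.free s) r∈
  ... | inj₁ r∈free = All.lookup (Split.free-cone s) r∈free
  ... | inj₂ r∈prod with ∈-cartesianProductWith⁻ _⊕_ (Split.lower s) (Split.upper s) r∈prod
  ... | l , u , l∈ , u∈ , refl =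
    add (All.lookup (Split.lower-cone s) l∈) (All.lookup (Split.upper-cone s) u∈)
        (λ { zero → refl ; (suc a) → refl }) refl

  -- The row `l ⊕ u` says exactly that the lower bound which `l` puts on the eliminated variable is
  -- at most the upper bound which `u` puts on it.
  eliminate-solve : ∀ {m} {rows : List (Row (suc m))} (s : Split rows) x → Feasible (eliminate s) x →
                    ∃ λ t → Feasible rows (t ◂ x)
  eliminate-solve s x h =
    let t , hl , hu = between (map below lower) (map above upper) (All.map⁺ (All.tabulate λ {l} l∈ →
                        All.map⁺ (All.tabulate λ {u} u∈ → below≤above {l} {u} (combined l∈ u∈))))
    in t , complete t x
         (All.map (λ {r} → from-below t r) (All.map⁻ hl))
         (All.map (λ {r} → from-above t r) (All.map⁻ hu))
         (All.map (λ {r} p → ≤-trans p (≤-reflexive (drop-t t (dot (proj₁ r) x)))) (All.++⁻ˡ free h))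
    where
    open Split s
    below above : Row _ → ℚ
    below (α , β) = β - dot α x
    above (α , β) = dot α x - β
    combined : ∀ {l u} → l ∈ lower → u ∈ upper → Sat x (l ⊕ u)
    combined l∈ u∈ = All.lookup (All.++⁻ʳ free h) (∈-cartesianProductWith⁺ _⊕_ l∈ u∈)
    drop-t : ∀ t d → d ≡ 0ℚ * t + d
    drop-t = solve-∀ ℚ-ring
    below≤above : ∀ {l u} → Sat x (l ⊕ u) → below l ≤ above u
    below≤above {α , β} {α′ , β′} p = p+r≤q+r⇒p≤q (β′ + dot α x)
      (subst₂ _≤_ (lhs β β′ (dot α x)) (trans (dot-+ˡ α α′ x) (rhs (dot α x) (dot α′ x) β′)) p)
      where
      lhs : ∀ b b′ d → b + b′ ≡ b - d + (b′ + d)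
      lhs = solve-∀ ℚ-ring
      rhs : ∀ d d′ b′ → d + d′ ≡ d′ - b′ + (b′ + d)
      rhs = solve-∀ ℚ-ring
    from-below : ∀ t r → below r ≤ t → Sat (t ◂ x) (1ℚ ◂ proj₁ r , proj₂ r)
    from-below t (α , β) p = subst₂ _≤_ (lhs β (dot α x)) (rhs t (dot α x)) (+-monoˡ-≤ (dot α x) p)
      where
      lhs : ∀ b d → b - d + d ≡ b
      lhs = solve-∀ ℚ-ring
      rhs : ∀ t d → t + d ≡ 1ℚ * t + d
      rhs = solve-∀ ℚ-ring
    from-above : ∀ t r → t ≤ above r → Sat (t ◂ x) (- 1ℚ ◂ proj₁ r , proj₂ r)
    from-above t (α , β) p = subst₂ _≤_ (lhs t β) (rhs t (dot α x) β) (+-monoˡ-≤ (β - t) p)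
      where
      lhs : ∀ t b → t + (b - t) ≡ b
      lhs = solve-∀ ℚ-ring
      rhs : ∀ t d b → d - b + (b - t) ≡ - 1ℚ * t + d
      rhs = solve-∀ ℚ-ring

  -- With no variables left, a row reads β ≤ 0. A violated one is already a certificate, to be
  -- pulled back through the eliminations.
  fourier-motzkin : ∀ m (rows : List (Row m)) →
    (∃ λ x → Feasible rows x) ⊎ (∃ λ γ → 0ℚ < γ × Cone (_∈ rows) (λ _ → 0ℚ) γ)
  fourier-motzkin zero [] = inj₁ ((λ ()) , [])
  fourier-motzkin zero ((α , β) ∷ rows) with β ℚ.≤? 0ℚ | fourier-motzkin zero rows
  ... | no β≰0  | _ = inj₂ (β , ≰⇒> β≰0 , gen (here refl) (λ ()) refl)
  ... | yes β≤0 | inj₁ (x , h) = inj₁ (x , β≤0 ∷ h)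
  ... | yes β≤0 | inj₂ (γ , 0<γ , p) = inj₂ (γ , 0<γ , Cone-mono there p)
  fourier-motzkin (suc m) rows with fourier-motzkin m (eliminate (split rows))
  ... | inj₁ (x , h) = let t , h′ = eliminate-solve (split rows) x h in inj₁ (t ◂ x , h′)
  ... | inj₂ (γ , 0<γ , p) = inj₂ (γ , 0<γ ,
    -- Scaling by 1 serves only to exchange `0ℚ ◂ (λ _ → 0ℚ)` for the pointwise equal `λ _ → 0ℚ`.
    scale 0<1 (Cone-bind (eliminate-cone (split rows)) p)
      (λ { zero → refl ; (suc a) → refl }) (sym (*-identityˡ γ)))

  -- Farkas' lemma at an optimum: a multiple of the cost as a sum of tight rows

  Tight : ∀ {m} → System m → (Fin m → ℚ) → Row m → Set
  Tight rows x r = r ∈ rows × proj₂ r ≡ dot (proj₁ r) x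

  rowSum : ∀ {m} → List (Row m) → Fin m → ℚ
  rowSum []      a = 0ℚ
  rowSum (r ∷ L) a = proj₁ r a + rowSum L a

  copies : ∀ {A : Set} → ℕ → List A → List A
  copies k L = concat (replicate k L)

  All-copies : ∀ {A : Set} {P : A → Set} k {L} → All P L → All P (copies k L)
  All-copies k h = All.concat⁺ (All.replicate⁺ k h)

  rowSum-++ : ∀ {m} (L L′ : List (Row m)) a → rowSum (L ++ L′) a ≡ rowSum L a + rowSum L′ a
  rowSum-++ []      L′ a = sym (+-identityˡ _)
  rowSum-++ (r ∷ L) L′ a = trans (cong (proj₁ r a +_) (rowSum-++ L L′ a)) (sym (+-assoc (proj₁ r a) _ _))

  rowSum-copies : ∀ {m} k (L : List (Row m)) a → rowSum (copies k L) a ≡ ⟦ k ⟧ * rowSum L a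
  rowSum-copies zero    L a = trans (sym (*-zeroˡ (rowSum L a))) (cong (_* rowSum L a) (sym ⟦0⟧))
  rowSum-copies (suc k) L a = begin
    rowSum (L ++ copies k L) a        ≡⟨ rowSum-++ L (copies k L) a ⟩
    rowSum L a + rowSum (copies k L) a ≡⟨ cong (rowSum L a +_) (rowSum-copies k L a) ⟩
    rowSum L a + ⟦ k ⟧ * rowSum L a   ≡⟨ lemma (rowSum L a) ⟦ k ⟧ ⟩
    (1ℚ + ⟦ k ⟧) * rowSum L a         ≡⟨ cong (_* rowSum L a) (trans (⟦⟧-+ 1 k) (cong (_+ ⟦ k ⟧) ⟦1⟧)) ⟨
    ⟦ suc k ⟧ * rowSum L a            ∎
    where
    open ≡-Reasoning
    lemma : ∀ s k → s + k * s ≡ (1ℚ + k) * s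
    lemma = solve-∀ ℚ-ring

  module Duality {m} (rows : System m) (c x : Fin m → ℚ) (x-feasible : Feasible rows x)
                 (x-optimal : ∀ x′ → Feasible rows x′ → dot c x ≤ dot c x′) where

    slackRow : Row m → Row (suc m)
    slackRow (α , β) = (dot α x - β) ◂ α , 0ℚ

    -- (t , d) satisfies these rows iff t ≥ 0, c·d ≤ -1 and α·d + t (α·x − β) ≥ 0 for each row (α , β);
    -- then x + d / (1 + t) is feasible and has smaller cost than x.
    descentRows : List (Row (suc m))
    descentRows = (1ℚ ◂ (λ _ → 0ℚ) , 0ℚ) ∷ (0ℚ ◂ (λ a → - 1ℚ * c a) , 1ℚ) ∷ map slackRow rows

    no-descent : ∀ y → ¬ Feasible descentRows y
    no-descent y (ht ∷ hd ∷ hs) = <-irrefl refl (<-≤-trans κ<0 κ-nonneg)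
      where
      t = y zero
      d = y ∘ suc
      0≤t : 0ℚ ≤ t
      0≤t = ≤-trans ht (≤-reflexive (trans (cong₂ _+_ (*-identityˡ t) (dot-zeroˡ d)) (+-identityʳ t)))
      0<1+t : 0ℚ < 1ℚ + t
      0<1+t = <-≤-trans 0<1 (≤-trans (≤-reflexive (sym (+-identityʳ 1ℚ))) (+-monoʳ-≤ 1ℚ 0≤t))
      inv = inverse-pos 0<1+t
      κ = proj₁ inv
      κ-inverse : κ * (1ℚ + t) ≡ 1ℚ
      κ-inverse = proj₂ (proj₂ inv)
      x′ : Fin m → ℚ
      x′ a = x a + κ * d a
      row-ok : ∀ {r} → r ∈ rows → Sat x′ r
      -- Multiplied by 1 + t, the slack of the row at `x′` is its slack at `x` plus the value of its
      -- row in `descentRows`, and both are nonnegative.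
      row-ok {r@(α , β)} r∈ = *-cancelˡ-≤ 0<1+t (p+r≤q+r⇒p≤q (- ((1ℚ + t) * β)) (begin
        (1ℚ + t) * β - (1ℚ + t) * β             ≡⟨ +-inverseʳ ((1ℚ + t) * β) ⟩
        0ℚ                                      ≤⟨ +-nonNeg (p≤q⇒0≤q-p (All.lookup x-feasible r∈))
                                                            (All.lookup (All.map⁻ hs) r∈) ⟩
        (αx - β) + ((αx - β) * t + αd)          ≡⟨ lemma αx β t αd ⟩
        (1ℚ + t) * αx + 1ℚ * αd - (1ℚ + t) * β  ≡⟨ cong (λ e → (1ℚ + t) * αx + e * αd - (1ℚ + t) * β) (sym κ-inverse) ⟩
        (1ℚ + t) * αx + κ * (1ℚ + t) * αd - (1ℚ + t) * β ≡⟨ lemma′ αx κ αd t β ⟩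
        (1ℚ + t) * (αx + κ * αd) - (1ℚ + t) * β ≡⟨ cong (λ e → (1ℚ + t) * e - (1ℚ + t) * β) (sym (dot-step α x d κ)) ⟩
        (1ℚ + t) * dot α x′ - (1ℚ + t) * β      ∎))
        where
        open ≤-Reasoning
        αx = dot α x
        αd = dot α d
        lemma : ∀ αx β t αd → (αx - β) + ((αx - β) * t + αd) ≡ (1ℚ + t) * αx + 1ℚ * αd - (1ℚ + t) * β
        lemma = solve-∀ ℚ-ring
        lemma′ : ∀ αx κ αd t β → (1ℚ + t) * αx + κ * (1ℚ + t) * αd - (1ℚ + t) * β
                               ≡ (1ℚ + t) * (αx + κ * αd) - (1ℚ + t) * β
        lemma′ = solve-∀ ℚ-ring
      κ-nonneg : 0ℚ ≤ κ * dot c d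
      κ-nonneg = p+r≤q+r⇒p≤q (dot c x) (subst₂ _≤_ (sym (+-identityˡ _))
        (trans (dot-step c x d κ) (+-comm (dot c x) _)) (x-optimal x′ (All.tabulate row-ok)))
      κ<0 : κ * dot c d < 0ℚ
      κ<0 = ≤-<-trans (*-monoˡ-≤ (<⇒≤ (proj₁ (proj₂ inv))) c·d≤-1)
              (subst (_< 0ℚ) (lemma κ) (neg-antimono-< (proj₁ (proj₂ inv))))
        where
        lemma : ∀ κ → - κ ≡ κ * - 1ℚ
        lemma = solve-∀ ℚ-ring
        c·d≤-1 : dot c d ≤ - 1ℚ
        c·d≤-1 = subst (_≤ - 1ℚ) (trans (cong -_ (dot-*ˡ (- 1ℚ) c d)) (lemma₁ (dot c d)))
                  (neg-antimono-≤ (subst (1ℚ ≤_) (lemma₂ t _) hd))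
          where
          lemma₁ : ∀ e → - (- 1ℚ * e) ≡ e
          lemma₁ = solve-∀ ℚ-ring
          lemma₂ : ∀ t e → 0ℚ * t + e ≡ e
          lemma₂ = solve-∀ ℚ-ring

    -- A vanishing first coordinate forces every slack in the combination to be 0.
    TightCombination : (Fin (suc m) → ℚ) → ℚ → Set
    TightCombination v γ = 0ℚ ≤ v zero × (v zero ≡ 0ℚ → ∃ λ N → ∃ λ M → ∃ λ L → N ≢ 0 × All (Tight rows x) L ×
      ⟦ N ⟧ * γ ≡ ⟦ M ⟧ × (∀ a → ⟦ N ⟧ * v (suc a) + ⟦ M ⟧ * c a ≡ rowSum L a))

    -- The cost row alone has a nonzero right-hand side, so `γ` measures how much of it is used; `M`
    -- is that amount after clearing denominators by `N`. Moving the cost row across leaves a sum of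
    -- tight rows.
    tight-combination : ∀ {v γ} → Cone (_∈ descentRows) v γ → TightCombination v γ
    tight-combination {v} (gen (here refl) e e′) =
      subst (0ℚ ≤_) (sym (e zero)) (<⇒≤ 0<1) , λ v₀≡0 → ⊥-elim (1≢0 (trans (sym (e zero)) v₀≡0))
    tight-combination {v} (gen (there (here refl)) e e′) =
      ≤-reflexive (sym (e zero)) , λ _ → 1 , 1 , [] , (λ ()) , [] ,
      trans (cong₂ _*_ ⟦1⟧ e′) (sym ⟦1⟧) , λ a → trans (cong₂ (λ u i → i * u + i * c a) (e (suc a)) ⟦1⟧) (lemma (c a))
      where
      lemma : ∀ c → 1ℚ * (- 1ℚ * c) + 1ℚ * c ≡ 0ℚ
      lemma = solve-∀ ℚ-ring
    tight-combination {v} (gen (there (there r∈)) e e′) with ∈-map⁻ slackRow r∈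
    ... | r@(α , β) , r∈rows , refl =
      subst (0ℚ ≤_) (sym (e zero)) (p≤q⇒0≤q-p (All.lookup x-feasible r∈rows)) ,
      λ v₀≡0 → 1 , 0 , r ∷ [] , (λ ()) ,
        (r∈rows , trans (lemma₁ (dot α x) β) (trans (cong (λ s → dot α x - s) (trans (sym (e zero)) v₀≡0)) (lemma₂ (dot α x)))) ∷ [] ,
        trans (cong (⟦ 1 ⟧ *_) e′) (trans (*-zeroʳ ⟦ 1 ⟧) (sym ⟦0⟧)) ,
        λ a → trans (cong₂ (λ i z → i * v (suc a) + z * c a) ⟦1⟧ ⟦0⟧) (trans (cong (λ u → 1ℚ * u + 0ℚ * c a) (e (suc a))) (lemma₃ (α a) (c a)))
      where
      lemma₁ : ∀ d b → b ≡ d - (d - b)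
      lemma₁ = solve-∀ ℚ-ring
      lemma₂ : ∀ d → d - 0ℚ ≡ d
      lemma₂ = solve-∀ ℚ-ring
      lemma₃ : ∀ α c → 1ℚ * α + 0ℚ * c ≡ α + 0ℚ
      lemma₃ = solve-∀ ℚ-ring
    tight-combination {v} {γ} (add {v′} {v″} {γ′} {γ″} p q e e′) with tight-combination p | tight-combination q
    ... | 0≤v′ , f′ | 0≤v″ , f″ = subst (0ℚ ≤_) (sym (e zero)) (+-nonNeg 0≤v′ 0≤v″) , combine
      where
      combine : v zero ≡ 0ℚ → _
      combine v₀≡0 with nonNeg-sum-0 0≤v′ 0≤v″ (trans (sym (e zero)) v₀≡0)
      ... | z′ , z″ with f′ z′ | f″ z″
      ... | N′ , M′ , L′ , N′≢0 , T′ , g′ , h′ | N″ , M″ , L″ , N″≢0 , T″ , g″ , h″ =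
        -- Common multiplier: the first list is repeated N″ times, the second N′ times.
        N′ ℕ.* N″ , N″ ℕ.* M′ ℕ.+ N′ ℕ.* M″ , copies N″ L′ ++ copies N′ L″ ,
        (λ e → [ N′≢0 , N″≢0 ]′ (ℕ.m*n≡0⇒m≡0∨n≡0 N′ e)) ,
        All.++⁺ (All-copies N″ T′) (All-copies N′ T″) ,
        (begin
          ⟦ N′ ℕ.* N″ ⟧ * γ                          ≡⟨ cong₂ _*_ (⟦⟧-* N′ N″) e′ ⟩
          ⟦ N′ ⟧ * ⟦ N″ ⟧ * (γ′ + γ″)                ≡⟨ lemma₁ ⟦ N′ ⟧ ⟦ N″ ⟧ γ′ γ″ ⟩
          ⟦ N″ ⟧ * (⟦ N′ ⟧ * γ′) + ⟦ N′ ⟧ * (⟦ N″ ⟧ * γ″) ≡⟨ cong₂ (λ p q → ⟦ N″ ⟧ * p + ⟦ N′ ⟧ * q) g′ g″ ⟩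
          ⟦ N″ ⟧ * ⟦ M′ ⟧ + ⟦ N′ ⟧ * ⟦ M″ ⟧          ≡⟨ M-eq ⟨
          ⟦ N″ ℕ.* M′ ℕ.+ N′ ℕ.* M″ ⟧                ∎) ,
        λ a → begin
          ⟦ N′ ℕ.* N″ ⟧ * v (suc a) + ⟦ N″ ℕ.* M′ ℕ.+ N′ ℕ.* M″ ⟧ * c a
            ≡⟨ cong₂ (λ p q → p + q * c a) (cong₂ _*_ (⟦⟧-* N′ N″) (e (suc a))) M-eq ⟩
          ⟦ N′ ⟧ * ⟦ N″ ⟧ * (v′ (suc a) + v″ (suc a)) + (⟦ N″ ⟧ * ⟦ M′ ⟧ + ⟦ N′ ⟧ * ⟦ M″ ⟧) * c a
            ≡⟨ lemma₂ ⟦ N′ ⟧ ⟦ N″ ⟧ (v′ (suc a)) (v″ (suc a)) ⟦ M′ ⟧ ⟦ M″ ⟧ (c a) ⟩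
          ⟦ N″ ⟧ * (⟦ N′ ⟧ * v′ (suc a) + ⟦ M′ ⟧ * c a) + ⟦ N′ ⟧ * (⟦ N″ ⟧ * v″ (suc a) + ⟦ M″ ⟧ * c a)
            ≡⟨ cong₂ (λ p q → ⟦ N″ ⟧ * p + ⟦ N′ ⟧ * q) (h′ a) (h″ a) ⟩
          ⟦ N″ ⟧ * rowSum L′ a + ⟦ N′ ⟧ * rowSum L″ a
            ≡⟨ cong₂ _+_ (rowSum-copies N″ L′ a) (rowSum-copies N′ L″ a) ⟨
          rowSum (copies N″ L′) a + rowSum (copies N′ L″) a
            ≡⟨ rowSum-++ (copies N″ L′) (copies N′ L″) a ⟨
          rowSum (copies N″ L′ ++ copies N′ L″) a ∎
        where
        open ≡-Reasoning
        M-eq : ⟦ N″ ℕ.* M′ ℕ.+ N′ ℕ.* M″ ⟧ ≡ ⟦ N″ ⟧ * ⟦ M′ ⟧ + ⟦ N′ ⟧ * ⟦ M″ ⟧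
        M-eq = trans (⟦⟧-+ (N″ ℕ.* M′) (N′ ℕ.* M″)) (cong₂ _+_ (⟦⟧-* N″ M′) (⟦⟧-* N′ M″))
        lemma₁ : ∀ a b g h → a * b * (g + h) ≡ b * (a * g) + a * (b * h)
        lemma₁ = solve-∀ ℚ-ring
        lemma₂ : ∀ a b v w p q c → a * b * (v + w) + (b * p + a * q) * c ≡ b * (a * v + p * c) + a * (b * w + q * c)
        lemma₂ = solve-∀ ℚ-ring
    tight-combination {v} {γ} (scale {q} {v′} {γ′} 0<q p e e′) with tight-combination p | numden 0<q
    ... | 0≤v′ , f′ | k , r , r≢0 , rq≡k =
      subst (0ℚ ≤_) (sym (e zero)) (*-nonNeg (<⇒≤ 0<q) 0≤v′) , rescale
      where
      rescale : v zero ≡ 0ℚ → _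
      rescale v₀≡0 with f′ (≤-antisym (*-cancelˡ-≤ 0<q (≤-reflexive (trans (sym (e zero)) (trans v₀≡0 (sym (*-zeroʳ q)))))) 0≤v′)
      ... | N , M , L , N≢0 , T , g , h =
        -- With q = k / r, the multiplier r N turns the scaling into k copies of the list.
        r ℕ.* N , k ℕ.* M , copies k L ,
        (λ e → [ r≢0 , N≢0 ]′ (ℕ.m*n≡0⇒m≡0∨n≡0 r e)) ,
        All-copies k T ,
        (begin
          ⟦ r ℕ.* N ⟧ * γ             ≡⟨ cong₂ _*_ (⟦⟧-* r N) e′ ⟩
          ⟦ r ⟧ * ⟦ N ⟧ * (q * γ′)     ≡⟨ lemma₁ ⟦ r ⟧ ⟦ N ⟧ q γ′ ⟩
          ⟦ r ⟧ * q * (⟦ N ⟧ * γ′)     ≡⟨ cong₂ _*_ rq≡k g ⟩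
          ⟦ k ⟧ * ⟦ M ⟧                ≡⟨ ⟦⟧-* k M ⟨
          ⟦ k ℕ.* M ⟧                  ∎) ,
        λ a → begin
          ⟦ r ℕ.* N ⟧ * v (suc a) + ⟦ k ℕ.* M ⟧ * c a
            ≡⟨ cong₂ (λ p q → p + q * c a) (cong₂ _*_ (⟦⟧-* r N) (e (suc a))) (⟦⟧-* k M) ⟩
          ⟦ r ⟧ * ⟦ N ⟧ * (q * v′ (suc a)) + ⟦ k ⟧ * ⟦ M ⟧ * c a
            ≡⟨ cong (_+ ⟦ k ⟧ * ⟦ M ⟧ * c a) (trans (lemma₁ ⟦ r ⟧ ⟦ N ⟧ q (v′ (suc a))) (cong (_* (⟦ N ⟧ * v′ (suc a))) rq≡k)) ⟩
          ⟦ k ⟧ * (⟦ N ⟧ * v′ (suc a)) + ⟦ k ⟧ * ⟦ M ⟧ * c a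
            ≡⟨ lemma₂ ⟦ k ⟧ (⟦ N ⟧ * v′ (suc a)) ⟦ M ⟧ (c a) ⟩
          ⟦ k ⟧ * (⟦ N ⟧ * v′ (suc a) + ⟦ M ⟧ * c a)
            ≡⟨ cong (⟦ k ⟧ *_) (h a) ⟩
          ⟦ k ⟧ * rowSum L a
            ≡⟨ rowSum-copies k L a ⟨
          rowSum (copies k L) a ∎
        where
        open ≡-Reasoning
        lemma₁ : ∀ r n q g → r * n * (q * g) ≡ r * q * (n * g)
        lemma₁ = solve-∀ ℚ-ring
        lemma₂ : ∀ k n m c → k * n + k * m * c ≡ k * (n + m * c)
        lemma₂ = solve-∀ ℚ-ring

    -- No descent exists at an optimum, so elimination returns a certificate. Since N γ = M with γ >
    -- 0, the cost row does occur in it.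
    cost-from-tight-rows : ∃₂ λ M L → M ≢ 0 × All (Tight rows x) L × ∀ a → ⟦ M ⟧ * c a ≡ rowSum L a
    cost-from-tight-rows with fourier-motzkin (suc m) descentRows
    ... | inj₁ (y , h) = ⊥-elim (no-descent y h)
    ... | inj₂ (γ , 0<γ , p) with proj₂ (tight-combination p) refl
    ... | N , M , L , N≢0 , T , g , h = M , L , M≢0 , T , λ a →
      trans (lemma ⟦ N ⟧ (⟦ M ⟧ * c a)) (h a)
      where
      lemma : ∀ n e → e ≡ n * 0ℚ + e
      lemma = solve-∀ ℚ-ring
      M≢0 : M ≢ 0
      M≢0 refl = <-irrefl (sym (γ≡0)) 0<γ
        where
        0<N : 0ℚ < ⟦ N ⟧
        0<N = ⟦⟧-pos N≢0
        γ≡0 : γ ≡ 0ℚ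
        γ≡0 = ≤-antisym (*-cancelˡ-≤ 0<N (≤-reflexive (trans g (trans ⟦0⟧ (sym (*-zeroʳ ⟦ N ⟧)))))) (<⇒≤ 0<γ)

  -- Boolean predicates, unit vectors, and bicuts as nonempty sets on one side

  ∧-true : ∀ {p q} → p ∧ q ≡ true → p ≡ true × q ≡ true
  ∧-true {true} {true} _ = refl , refl

  ∧∨-true : ∀ {p q r} → p ≡ true → q ≡ true → (p ∧ q) ∨ r ≡ true
  ∧∨-true refl refl = refl

  ∨∧-true : ∀ {p q r} → q ≡ true → r ≡ true → p ∨ (q ∧ r) ≡ true
  ∨∧-true {p} refl refl = ∨-zeroʳ p

  not-true : ∀ {p} → not p ≡ true → p ≡ false
  not-true {false} _ = refl

  true≢false : ∀ {p} → p ≡ true → p ≡ false → ⊥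
  true≢false refl ()

  allSubsets-complete : ∀ {n} (U : Vec Bool n) → U ∈ allSubsets n
  allSubsets-complete []          = here refl
  allSubsets-complete (false ∷ U) = ∈-concatMap⁺ _ (Any.map (λ { refl → here refl }) (allSubsets-complete U))
  allSubsets-complete (true ∷ U)  = ∈-concatMap⁺ _ (Any.map (λ { refl → there (here refl) }) (allSubsets-complete U))

  indicator-toℚ : ∀ p → indicator p ≡ toℚ (ℤ.+ bit p)
  indicator-toℚ false = refl
  indicator-toℚ true  = refl

  unit-suc : ∀ {k} (i j : Fin k) {A : Set} (p q : A) →
             (if ⌊ suc i ≟ suc j ⌋ then p else q) ≡ (if ⌊ i ≟ j ⌋ then p else q)
  unit-suc i j p q with i ≟ j
  ... | yes _ = refl
  ... | no  _ = refl

  dot-unitVec : ∀ {k} i q (f : Fin k → ℚ) → dot (unitVec i q) f ≡ q * f i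
  dot-unitVec {suc k} zero q f =
    trans (cong (q * f zero +_) (∑-zero (λ j → *-zeroˡ (f (suc j))))) (+-identityʳ _)
  dot-unitVec {suc k} (suc i) q f = begin
    0ℚ * f zero + ∑ (λ j → unitVec (suc i) q (suc j) * f (suc j)) ≡⟨ cong (_+ ∑ (λ j → unitVec (suc i) q (suc j) * f (suc j))) (*-zeroˡ (f zero)) ⟩
    0ℚ + ∑ (λ j → unitVec (suc i) q (suc j) * f (suc j)) ≡⟨ +-identityˡ _ ⟩
    ∑ (λ j → unitVec (suc i) q (suc j) * f (suc j)) ≡⟨ ∑-cong (λ j → cong (_* f (suc j)) (unit-suc i j q 0ℚ)) ⟩
    dot (unitVec i q) (f ∘ suc) ≡⟨ dot-unitVec i q (f ∘ suc) ⟩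
    q * f (suc i) ∎
    where open ≡-Reasoning

  ∑-unitVec : ∀ {k} (f : Fin k → ℚ) j → ∑ (λ i → unitVec i (f i) j) ≡ f j
  ∑-unitVec {suc k} f zero = trans (cong (f zero +_) (∑-zero {k} {λ i → unitVec (suc i) (f (suc i)) zero} (λ i → refl))) (+-identityʳ _)
  ∑-unitVec {suc k} f (suc j) = trans (+-identityˡ _)
    (trans (∑-cong (λ i → unit-suc i j (f (suc i)) 0ℚ)) (∑-unitVec (f ∘ suc) j))

  module _ {n m : ℕ} (tail head : Fin m → Fin n) where

    allB-complete : ∀ {k} (f : Fin k → Bool) → (∀ i → f i ≡ true) → allB tail head f ≡ true
    allB-complete {zero}  f h = refl
    allB-complete {suc k} f h rewrite h zero = allB-complete (f ∘ suc) (h ∘ suc)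

    allB-sound : ∀ {k} (f : Fin k → Bool) → allB tail head f ≡ true → ∀ i → f i ≡ true
    allB-sound {suc k} f h zero    = proj₁ (∧-true h)
    allB-sound {suc k} f h (suc i) = allB-sound (f ∘ suc) (proj₂ (∧-true {f zero} h)) i

    allB-false : ∀ {k} (f : Fin k → Bool) → allB tail head f ≡ false → ∃ λ i → f i ≡ false
    allB-false {suc k} f h with f zero in e
    ... | false = zero , e
    ... | true  = let i , p = allB-false (f ∘ suc) h in suc i , p

    anyB-complete : ∀ {k} (f : Fin k → Bool) i → f i ≡ true → anyB tail head f ≡ true
    anyB-complete f i h with allB tail head (not ∘ f) in e
    ... | false = refl
    ... | true  = ⊥-elim (true≢false h (not-true (allB-sound (not ∘ f) e i)))

    anyB-sound : ∀ {k} (f : Fin k → Bool) → anyB tail head f ≡ true → ∃ λ i → f i ≡ true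
    anyB-sound f h = let i , p = allB-false (not ∘ f) (not-true h) in i , lemma p
      where
      lemma : ∀ {p} → not p ≡ false → p ≡ true
      lemma {true} _ = refl

  -- The bicuts come from nonempty subsets of T and from complements of nonempty subsets of S;
  -- mem false U is membership in U, mem true U is membership in the complement of U.
  mem : ∀ {n} → Bool → Subset n → Fin n → Bool
  mem side U v = side xor lookup U v

  module _ {n : ℕ} (inS : Fin n → Bool) where

    SideSet : Bool → Subset n → Set
    SideSet side U = (∀ v → mem side U v ≡ true → inS v ≡ side) × (∃ λ v → mem side U v ≡ true)

    module _ {m : ℕ} (tail head : Fin m → Fin n) where

      SideSet⇒bicut : ∀ side U → SideSet side U → isBicutSet tail head inS U ≡ true
      SideSet⇒bicut false U (sub , v , Uv) =
        ∧∨-true (anyB-complete tail head (lookup U) v Uv) (allB-complete tail head _ inT)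
        where
        inT : ∀ v → not (lookup U v) ∨ not (inS v) ≡ true
        inT v with lookup U v in e
        ... | false = refl
        ... | true  = cong not (sub v e)
      SideSet⇒bicut true U (sub , v , Uv) =
        ∨∧-true (allB-complete tail head _ T⊆) (anyB-complete tail head (not ∘ lookup U) v Uv)
        where
        T⊆ : ∀ v → inS v ∨ lookup U v ≡ true
        T⊆ v with lookup U v in e
        ... | true  = ∨-zeroʳ (inS v)
        ... | false = cong (_∨ false) (sub v (cong not e))

      bicut⇒SideSet : ∀ U → isBicutSet tail head inS U ≡ true → ∃ λ side → SideSet side U
      bicut⇒SideSet U h with anyB tail head (lookup U) ∧ allB tail head (λ v → not (lookup U v) ∨ not (inS v)) in e
      ... | true = false , inT , anyB-sound tail head (lookup U) (proj₁ (∧-true e))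
        where
        inT : ∀ v → lookup U v ≡ true → inS v ≡ false
        inT v Uv with allB-sound tail head _ (proj₂ (∧-true {anyB tail head (lookup U)} e)) v
        ... | q rewrite Uv = not-true q
      ... | false = true , ⊆S , anyB-sound tail head (not ∘ lookup U)
            (proj₂ (∧-true {allB tail head (λ v → inS v ∨ lookup U v)} h))
        where
        ⊆S : ∀ v → not (lookup U v) ≡ true → inS v ≡ true
        ⊆S v Uv with inS v | allB-sound tail head (λ v → inS v ∨ lookup U v) (proj₁ (∧-true h)) v
        ... | true  | _ = refl
        ... | false | q = ⊥-elim (true≢false q (not-true Uv))

    -- Only nonemptiness is at stake: that of `U ∩ W` on the T side, and that of the complement of
    -- `U ∪ W` on the S side. The last two regions of a crossing provide the vertices.
    SideSet-∩∪ : ∀ side {U W} → SideSet side U → SideSet side W → Crossing U W →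
                 SideSet side (U ∩ W) × SideSet side (U ∪ W)
    SideSet-∩∪ false {U} {W} (subU , _) (subW , _) (_ , _ , (i , Ui , Wi) , _) =
      (sub∩ , i , trans (lookup-∩ U W i) (cong₂ _∧_ Ui Wi)) ,
      (sub∪ , i , trans (lookup-∪ U W i) (cong₂ _∨_ Ui Wi))
      where
      sub∩ : ∀ v → lookup (U ∩ W) v ≡ true → inS v ≡ false
      sub∩ v h = subU v (proj₁ (∧-true (trans (sym (lookup-∩ U W v)) h)))
      sub∪ : ∀ v → lookup (U ∪ W) v ≡ true → inS v ≡ false
      sub∪ v h with lookup U v in Uv | trans (sym (lookup-∪ U W v)) h
      ... | true  | _  = subU v Uv
      ... | false | Wv = subW v Wv
    SideSet-∩∪ true {U} {W} (subU , _) (subW , _) (_ , _ , _ , (o , Uo , Wo)) =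
      (sub∩ , o , cong not (trans (lookup-∩ U W o) (cong₂ _∧_ Uo Wo))) ,
      (sub∪ , o , cong not (trans (lookup-∪ U W o) (cong₂ _∨_ Uo Wo)))
      where
      sub∩ : ∀ v → not (lookup (U ∩ W) v) ≡ true → inS v ≡ true
      sub∩ v h with lookup U v in Uv | trans (sym (cong not (lookup-∩ U W v))) h
      ... | false | _  = subU v (cong not Uv)
      ... | true  | Wv = subW v Wv
      sub∪ : ∀ v → not (lookup (U ∪ W) v) ≡ true → inS v ≡ true
      sub∪ v h with lookup U v in Uv | trans (sym (cong not (lookup-∪ U W v))) h
      ... | false | _ = subU v (cong not Uv)

    Single : Bool → Subset n → Set
    Single side U = ∀ v w → mem side U v ≡ true → mem side U w ≡ true → v ≡ w

    -- On its side, each of two crossing sets has a vertex shared with the other and a vertex of its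
    -- own.
    Crossing⇒¬Single : ∀ side U W → Crossing U W → ¬ Single side U × ¬ Single side W
    Crossing⇒¬Single false U W ((v , Uv , ¬Wv) , (w , ¬Uw , Ww) , (i , Ui , Wi) , _) =
      (λ s → true≢false (subst (λ j → lookup W j ≡ true) (s i v Ui Uv) Wi) ¬Wv) ,
      (λ s → true≢false (subst (λ j → lookup U j ≡ true) (s i w Wi Ww) Ui) ¬Uw)
    Crossing⇒¬Single true U W ((v , Uv , ¬Wv) , (w , ¬Uw , Ww) , _ , (o , ¬Uo , ¬Wo)) =
      (λ s → true≢false Ww (subst (λ j → lookup W j ≡ false) (s o w (cong not ¬Uo) (cong not ¬Uw)) ¬Wo)) ,
      (λ s → true≢false Uv (subst (λ j → lookup U j ≡ false) (s o v (cong not ¬Wo) (cong not ¬Wv)) ¬Uo))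

  -- Integral dual solutions

  module _ {m} (rows : System m) (x : Fin m → ℚ) where

    -- The objective is recorded as α·x, which is complementary slackness in a form closed under
    -- addition; for the cost vector it certifies optimality by weak duality.
    IntegralDual : (Fin m → ℚ) → Set
    IntegralDual α = ∃ λ (y : Fin (List.length rows) → ℤ) →
      (∀ i → ℤ.0ℤ ℤ.≤ y i) ×
      (∀ a → ∑ (λ i → toℚ (y i) * proj₁ (List.lookup rows i) a) ≡ α a) ×
      dualObj rows (λ i → toℚ (y i)) ≡ dot α x

    IntegralDual-resp : ∀ {α α′} → (∀ a → α a ≡ α′ a) → IntegralDual α → IntegralDual α′
    IntegralDual-resp e (y , nn , eq , obj) = y , nn , (λ a → trans (eq a) (e a)) , trans obj (dot-cong x e)

    IntegralDual-zero : IntegralDual (λ _ → 0ℚ)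
    IntegralDual-zero = (λ _ → ℤ.0ℤ) , (λ _ → ℤ.≤-refl) ,
      (λ a → ∑-zero (λ i → *-zeroˡ (proj₁ (List.lookup rows i) a))) ,
      trans (∑-zero (λ i → *-zeroˡ (proj₂ (List.lookup rows i)))) (sym (dot-zeroˡ x))

    IntegralDual-+ : ∀ {α α′} → IntegralDual α → IntegralDual α′ → IntegralDual (λ a → α a + α′ a)
    IntegralDual-+ {α} {α′} (y , nn , eq , obj) (y′ , nn′ , eq′ , obj′) =
      (λ i → y i ℤ.+ y′ i) , (λ i → ℤ.+-mono-≤ (nn i) (nn′ i)) ,
      (λ a → trans (distribute (λ i → proj₁ (List.lookup rows i) a)) (cong₂ _+_ (eq a) (eq′ a))) ,
      trans (distribute (λ i → proj₂ (List.lookup rows i))) (trans (cong₂ _+_ obj obj′) (sym (dot-+ˡ α α′ x)))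
      where
      distribute : ∀ (f : Fin (List.length rows) → ℚ) →
        ∑ (λ i → toℚ (y i ℤ.+ y′ i) * f i) ≡ ∑ (λ i → toℚ (y i) * f i) + ∑ (λ i → toℚ (y′ i) * f i)
      distribute f = trans (∑-cong (λ i → trans (cong (_* f i) (toℚ-+ (y i) (y′ i)))
        (*-distribʳ-+ (f i) (toℚ (y i)) (toℚ (y′ i))))) (∑-+ (λ i → toℚ (y i) * f i) _)

    IntegralDual-* : ∀ {α} k → IntegralDual α → IntegralDual (λ a → toℚ (ℤ.+ k) * α a)
    IntegralDual-* {α} zero d = IntegralDual-resp (λ a → sym (*-zeroˡ (α a))) IntegralDual-zero
    IntegralDual-* {α} (suc k) d = IntegralDual-resp (λ a → trans (lemma (α a) (toℚ (ℤ.+ k)))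
      (cong (_* α a) (sym (toℚ-+ (ℤ.+ 1) (ℤ.+ k))))) (IntegralDual-+ d (IntegralDual-* k d))
      where
      lemma : ∀ α k → α + k * α ≡ (1ℚ + k) * α
      lemma = solve-∀ ℚ-ring

    IntegralDual-∑ : ∀ {k} (f : Fin k → Fin m → ℚ) → (∀ i → IntegralDual (f i)) →
                     IntegralDual (λ a → ∑ (λ i → f i a))
    IntegralDual-∑ {zero}  f d = IntegralDual-zero
    IntegralDual-∑ {suc k} f d = IntegralDual-+ (d zero) (IntegralDual-∑ (f ∘ suc) (d ∘ suc))

    HasTightRow : (Fin m → ℚ) → Set
    HasTightRow α = ∃ λ r → Tight rows x r × (∀ a → proj₁ r a ≡ α a)

    IntegralDual-row : ∀ {α} → HasTightRow α → IntegralDual α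
    IntegralDual-row {α} (r , (r∈ , tight) , e) = y , nn ,
      (λ a → trans (select (λ i → proj₁ (List.lookup rows i) a))
                   (trans (cong (λ r → proj₁ r a) (sym (lookup-index r∈))) (e a))) ,
      trans (select (λ i → proj₂ (List.lookup rows i)))
            (trans (cong proj₂ (sym (lookup-index r∈))) (trans tight (dot-cong x e)))
      where
      i₀ = Any.index r∈
      y : Fin (List.length rows) → ℤ
      y i = if ⌊ i₀ ≟ i ⌋ then ℤ.1ℤ else ℤ.0ℤ
      nn : ∀ i → ℤ.0ℤ ℤ.≤ y i
      nn i with i₀ ≟ i
      ... | yes _ = ℤ.+≤+ ℕ.z≤n
      ... | no  _ = ℤ.≤-refl
      y-unit : ∀ i → toℚ (y i) ≡ unitVec i₀ 1ℚ i
      y-unit i with i₀ ≟ i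
      ... | yes _ = refl
      ... | no  _ = refl
      select : ∀ (f : Fin (List.length rows) → ℚ) → ∑ (λ i → toℚ (y i) * f i) ≡ f i₀
      select f = trans (∑-cong (λ i → cong (_* f i) (y-unit i))) (trans (dot-unitVec i₀ 1ℚ f) (*-identityˡ _))

    weak-duality : Feasible rows x → ∀ {c} y → DualFeasible rows c y → dualObj rows y ≤ dot c x
    weak-duality feasible {c} y (nn , eq) = begin
      ∑ (λ i → y i * proj₂ (row i))                     ≤⟨ ∑-mono-≤ (λ i → *-monoˡ-≤ (nn i) (All.lookup feasible (∈-lookup i))) ⟩
      ∑ (λ i → y i * dot (proj₁ (row i)) x)             ≡⟨ ∑-cong (λ i → sym (dot-*ˡ (y i) (proj₁ (row i)) x)) ⟩
      ∑ (λ i → ∑ (λ a → y i * proj₁ (row i) a * x a))   ≡⟨ ∑-swap (λ i a → y i * proj₁ (row i) a * x a) ⟩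
      ∑ (λ a → ∑ (λ i → y i * proj₁ (row i) a * x a))   ≡⟨ ∑-cong column ⟩
      dot c x                                           ∎
      where
      open ≤-Reasoning
      row = List.lookup rows
      column : ∀ a → ∑ (λ i → y i * proj₁ (row i) a * x a) ≡ c a * x a
      column a = begin-equality
        ∑ (λ i → y i * proj₁ (row i) a * x a)   ≡⟨ ∑-cong (λ i → *-comm (y i * proj₁ (row i) a) (x a)) ⟩
        ∑ (λ i → x a * (y i * proj₁ (row i) a)) ≡⟨ ∑-*ˡ (x a) (λ i → y i * proj₁ (row i) a) ⟩
        x a * ∑ (λ i → y i * proj₁ (row i) a)   ≡⟨ cong (x a *_) (eq a) ⟩
        x a * c a                               ≡⟨ *-comm (x a) (c a) ⟩
        c a * x a                               ∎

  indicator-nonneg : ∀ p {q} → 0ℚ ≤ q → 0ℚ ≤ indicator p * q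
  indicator-nonneg false {q} _ = ≤-reflexive (sym (*-zeroˡ q))
  indicator-nonneg true  {q} h = ≤-trans h (≤-reflexive (sym (*-identityˡ q)))

  indicator-null : ∀ p {q} → indicator p * q ≡ 0ℚ → p ≡ false ⊎ q ≡ 0ℚ
  indicator-null false     _ = inj₁ refl
  indicator-null true  {q} e = inj₂ (trans (sym (*-identityˡ q)) e)

  -- Meant for the cut values `p` and `q` of U ∩ W and U ∪ W and the x-value `r` of the arcs joining
  -- U ∖ W and W ∖ U.
  ones : ∀ {p q r} → 1ℚ ≤ p → 1ℚ ≤ q → 0ℚ ≤ r → 1ℚ + 1ℚ ≡ p + q + r → p ≡ 1ℚ × q ≡ 1ℚ × r ≡ 0ℚ
  ones {p} {q} {r} 1≤p 1≤q 0≤r e =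
    let p+q=0 , r=0 = nonNeg-sum-0 (+-nonNeg (p≤q⇒0≤q-p 1≤p) (p≤q⇒0≤q-p 1≤q)) 0≤r
                        (trans (lemma p q r) (cong (_+ - (1ℚ + 1ℚ)) (sym e)))
        p=0 , q=0 = nonNeg-sum-0 (p≤q⇒0≤q-p 1≤p) (p≤q⇒0≤q-p 1≤q) p+q=0
    in back p p=0 , back q q=0 , r=0
    where
    lemma : ∀ p q r → p + - 1ℚ + (q + - 1ℚ) + r ≡ p + q + r + - (1ℚ + 1ℚ)
    lemma = solve-∀ ℚ-ring
    lemma′ : ∀ p → p ≡ p + - 1ℚ + 1ℚ
    lemma′ = solve-∀ ℚ-ring
    back : ∀ p → p + - 1ℚ ≡ 0ℚ → p ≡ 1ℚ
    back p e = trans (lemma′ p) (cong (_+ 1ℚ) e)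

  -- Tight cuts and decompositions of a vector into tight rows

  module TightRows {n m : ℕ} (tail head : Fin m → Fin n) (inS : Fin n → Bool) (b : Fin n → ℕ)
                   (l u x : Fin m → ℚ) (feasible : Feasible (theSystem tail head inS b ++ boxRows l u) x) where

    rows : System m
    rows = theSystem tail head inS b ++ boxRows l u

    cut : Subset n → Fin m → ℚ
    cut = δ⁻ tail head

    bicut-row : ∀ side U → SideSet inS side U → (cut U , 1ℚ) ∈ rows
    bicut-row side U h = ∈-++⁺ˡ (∈-++⁺ʳ (map _ (allFin n)) (∈-++⁺ˡ (∈-map⁺ (λ U → cut U , 1ℚ)
      (∈-filter⁺ (T? ∘ isBicutSet tail head inS) (allSubsets-complete U)
        (Equivalence.from T-≡ (SideSet⇒bicut inS tail head side U h))))))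

    nonneg-row : ∀ a → (unitVec a 1ℚ , 0ℚ) ∈ rows
    nonneg-row a = ∈-++⁺ˡ (∈-++⁺ʳ (map _ (allFin n)) (∈-++⁺ʳ (map _ (filterᵇ _ (allSubsets n)))
      (∈-map⁺ (λ a → unitVec a 1ℚ , 0ℚ) (∈-allFin a))))

    x-nonneg : ∀ a → 0ℚ ≤ x a
    x-nonneg a = ≤-trans (All.lookup feasible (nonneg-row a))
      (≤-reflexive (trans (dot-unitVec a 1ℚ x) (*-identityˡ (x a))))

    cut-uncross : ∀ U W → dot (cut U) x + dot (cut W) x ≡
                  dot (cut (U ∩ W)) x + dot (cut (U ∪ W)) x + dot (λ a → indicator (joins tail head a U W)) x
    cut-uncross U W = begin
      dot (cut U) x + dot (cut W) x     ≡⟨ dot-+ˡ (cut U) (cut W) x ⟨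
      dot (λ a → cut U a + cut W a) x   ≡⟨ dot-cong x pointwise ⟩
      dot (λ a → cut (U ∩ W) a + cut (U ∪ W) a + join a) x ≡⟨ dot-+ˡ (λ a → cut (U ∩ W) a + cut (U ∪ W) a) join x ⟩
      dot (λ a → cut (U ∩ W) a + cut (U ∪ W) a) x + dot join x ≡⟨ cong (_+ dot join x) (dot-+ˡ (cut (U ∩ W)) (cut (U ∪ W)) x) ⟩
      dot (cut (U ∩ W)) x + dot (cut (U ∪ W)) x + dot join x ∎
      where
      open ≡-Reasoning
      join : Fin m → ℚ
      join a = indicator (joins tail head a U W)
      ind-+ : ∀ p q r s t → bit p ℕ.+ bit q ≡ bit r ℕ.+ bit s ℕ.+ bit t →
              indicator p + indicator q ≡ indicator r + indicator s + indicator t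
      ind-+ p q r s t e = begin
        indicator p + indicator q ≡⟨ cong₂ _+_ (indicator-toℚ p) (indicator-toℚ q) ⟩
        toℚ (ℤ.+ bit p) + toℚ (ℤ.+ bit q) ≡⟨ toℚ-+ (ℤ.+ bit p) (ℤ.+ bit q) ⟨
        toℚ (ℤ.+ (bit p ℕ.+ bit q)) ≡⟨ cong (λ k → toℚ (ℤ.+ k)) e ⟩
        toℚ (ℤ.+ (bit r ℕ.+ bit s ℕ.+ bit t)) ≡⟨ toℚ-+ (ℤ.+ (bit r ℕ.+ bit s)) (ℤ.+ bit t) ⟩
        toℚ (ℤ.+ (bit r ℕ.+ bit s)) + toℚ (ℤ.+ bit t) ≡⟨ cong (_+ toℚ (ℤ.+ bit t)) (toℚ-+ (ℤ.+ bit r) (ℤ.+ bit s)) ⟩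
        toℚ (ℤ.+ bit r) + toℚ (ℤ.+ bit s) + toℚ (ℤ.+ bit t)
          ≡⟨ cong₂ _+_ (cong₂ _+_ (indicator-toℚ r) (indicator-toℚ s)) (indicator-toℚ t) ⟨
        indicator r + indicator s + indicator t ∎
      pointwise : ∀ a → cut U a + cut W a ≡ cut (U ∩ W) a + cut (U ∪ W) a + join a
      pointwise a = ind-+ (enters tail head a U) (enters tail head a W) (enters tail head a (U ∩ W))
        (enters tail head a (U ∪ W)) (joins tail head a U W) (enters-uncross tail head U W a)

    -- A tight row of a vertex v is the cut of {v} or V ∖ {v}; every other tight cut has x-value 1.
    TightCut : Bool → Subset n → Set
    TightCut side U = SideSet inS side U × HasTightRow rows x (cut U) ×
                      (Single inS side U ⊎ dot (cut U) x ≡ 1ℚ)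

    tight-uncross : ∀ side {U W} → TightCut side U → TightCut side W → Crossing U W →
      TightCut side (U ∩ W) × TightCut side (U ∪ W) × (∀ a → joins tail head a U W ≡ false ⊎ x a ≡ 0ℚ)
    tight-uncross side {U} {W} (sU , _ , kU) (sW , _ , kW) UW =
      (s∩ , tight {U ∩ W} s∩ (proj₁ values) , inj₂ (proj₁ values)) ,
      (s∪ , tight {U ∪ W} s∪ (proj₁ (proj₂ values)) , inj₂ (proj₁ (proj₂ values))) , null
      where
      ss = SideSet-∩∪ inS side {U} {W} sU sW UW
      s∩ = proj₁ ss
      s∪ = proj₂ ss
      ¬single = Crossing⇒¬Single inS side U W UW
      value-1 : ∀ {X} → ¬ Single inS side X → Single inS side X ⊎ dot (cut X) x ≡ 1ℚ → dot (cut X) x ≡ 1ℚ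
      value-1 ¬s (inj₁ s) = ⊥-elim (¬s s)
      value-1 ¬s (inj₂ e) = e
      join : Fin m → ℚ
      join a = indicator (joins tail head a U W)
      join-nonneg : ∀ a → 0ℚ ≤ join a * x a
      join-nonneg a = indicator-nonneg (joins tail head a U W) (x-nonneg a)
      values : dot (cut (U ∩ W)) x ≡ 1ℚ × dot (cut (U ∪ W)) x ≡ 1ℚ × dot join x ≡ 0ℚ
      values = ones (All.lookup feasible (bicut-row side (U ∩ W) s∩)) (All.lookup feasible (bicut-row side (U ∪ W) s∪))
        (∑-nonNeg join-nonneg)
        (trans (cong₂ _+_ (sym (value-1 {U} (proj₁ ¬single) kU)) (sym (value-1 {W} (proj₂ ¬single) kW))) (cut-uncross U W))
      tight : ∀ {X} → SideSet inS side X → dot (cut X) x ≡ 1ℚ → HasTightRow rows x (cut X)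
      tight {X} s e = (cut X , 1ℚ) , (bicut-row side X s , sym e) , λ a → refl
      null : ∀ a → joins tail head a U W ≡ false ⊎ x a ≡ 0ℚ
      null a = indicator-null (joins tail head a U W) (∑-nonNeg-0 join-nonneg (proj₂ (proj₂ values)) a)

    -- Only the left-hand side is prescribed, so a tight lower bound of the box and a tight
    -- nonnegativity row are interchangeable.
    Lower Upper : Fin m → Set
    Lower a = HasTightRow rows x (unitVec a 1ℚ)
    Upper a = HasTightRow rows x (unitVec a (- 1ℚ))

    -- Describes the integer multiples of the unit vector of `a` that tight rows can produce. It
    -- depends on the sign of `z` alone, which is why rounding has to preserve only signs.
    Signed : Fin m → ℤ → Set
    Signed a z = (ℤ.0ℤ ℤ.≤ z ⊎ Upper a) × (z ℤ.≤ ℤ.0ℤ ⊎ Lower a)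

    Signed-zero : ∀ a → Signed a ℤ.0ℤ
    Signed-zero a = inj₁ ℤ.≤-refl , inj₁ ℤ.≤-refl

    Signed-+ : ∀ {a y z} → Signed a y → Signed a z → Signed a (y ℤ.+ z)
    Signed-+ (p , q) (p′ , q′) = merge ℤ.+-mono-≤ p p′ , merge ℤ.+-mono-≤ q q′
      where
      merge : ∀ {P Q R S : Set} → (P → Q → R) → P ⊎ S → Q ⊎ S → R ⊎ S
      merge f (inj₁ p) (inj₁ q) = inj₁ (f p q)
      merge f (inj₁ p) (inj₂ s) = inj₂ s
      merge f (inj₂ s) _        = inj₂ s

    null⇒Lower : ∀ a → x a ≡ 0ℚ → Lower a
    null⇒Lower a e = (unitVec a 1ℚ , 0ℚ) ,
      (nonneg-row a , sym (trans (dot-unitVec a 1ℚ x) (trans (*-identityˡ (x a)) e))) , λ _ → refl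

    unitℤ : Fin m → ℤ → Fin m → ℤ
    unitℤ a z a′ = if ⌊ a ≟ a′ ⌋ then z else ℤ.0ℤ

    toℚ-unitℤ : ∀ a z a′ → toℚ (unitℤ a z a′) ≡ unitVec a (toℚ z) a′
    toℚ-unitℤ a z a′ with a ≟ a′
    ... | yes _ = refl
    ... | no  _ = refl

    Signed-unitℤ : ∀ {a z} → Signed a z → ∀ a′ → Signed a′ (unitℤ a z a′)
    Signed-unitℤ {a} s a′ with a ≟ a′
    ... | yes refl = s
    ... | no  _    = Signed-zero a′

    enter : Fin m → Subset n → Bool
    enter = enters tail head

    -- A sum of tight rows sorted by kind: cuts of either side, and all rows supported on a single
    -- arc merged into one signed number per arc. It is used for M c before rounding and for c after
    -- it.
    record Decomposition (v : Fin m → ℚ) : Set where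
      field
        family : Bool → List (Subset n)
        slack  : Fin m → ℤ
        tight  : ∀ side → All (TightCut side) (family side)
        signed : ∀ a → Signed a (slack a)

      total : Fin m → ℤ
      total a = ℤ.+ count (enter a) (family false) ℤ.+ ℤ.+ count (enter a) (family true) ℤ.+ slack a

      field
        value : ∀ a → v a ≡ toℚ (total a)

    add-cut : ∀ side {U} {v w : Fin m → ℚ} → TightCut side U → (∀ a → w a ≡ cut U a) → Decomposition v →
              Decomposition (λ a → w a + v a)
    add-cut side {U} {v} {w} t e d = record
      { family = family′ side ; slack = slack ; tight = tight′ side t ; signed = signed
      ; value = λ a → trans (cong₂ _+_ (trans (e a) (indicator-toℚ (enter a U))) (value a))
          (trans (sym (toℚ-+ (ℤ.+ bit (enter a U)) (total a))) (cong toℚ (value′ side a))) }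
      where
      open Decomposition d
      family′ : Bool → Bool → List (Subset n)
      family′ false false = U ∷ family false
      family′ false true  = family true
      family′ true  false = family false
      family′ true  true  = U ∷ family true
      tight′ : ∀ side → TightCut side U → ∀ side′ → All (TightCut side′) (family′ side side′)
      tight′ false t false = t ∷ tight false
      tight′ false t true  = tight true
      tight′ true  t false = tight false
      tight′ true  t true  = t ∷ tight true
      value′ : ∀ side a → ℤ.+ bit (enter a U) ℤ.+ total a
        ≡ ℤ.+ count (enter a) (family′ side false) ℤ.+ ℤ.+ count (enter a) (family′ side true) ℤ.+ slack a
      value′ false a = trans (lemma (ℤ.+ bit (enter a U)) (ℤ.+ count (enter a) (family false)) (ℤ.+ count (enter a) (family true)) (slack a))
        (cong (λ k → k ℤ.+ ℤ.+ count (enter a) (family true) ℤ.+ slack a) (sym (ℤ.pos-+ (bit (enter a U)) (count (enter a) (family false)))))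
        where
        lemma : ∀ e f t z → e ℤ.+ (f ℤ.+ t ℤ.+ z) ≡ e ℤ.+ f ℤ.+ t ℤ.+ z
        lemma = ℤ-solve-∀
      value′ true a = trans (lemma (ℤ.+ bit (enter a U)) (ℤ.+ count (enter a) (family false)) (ℤ.+ count (enter a) (family true)) (slack a))
        (cong (λ k → ℤ.+ count (enter a) (family false) ℤ.+ k ℤ.+ slack a) (sym (ℤ.pos-+ (bit (enter a U)) (count (enter a) (family true)))))
        where
        lemma : ∀ e f t z → e ℤ.+ (f ℤ.+ t ℤ.+ z) ≡ f ℤ.+ (e ℤ.+ t) ℤ.+ z
        lemma = ℤ-solve-∀

    add-arc : ∀ {a₀ z} {v w : Fin m → ℚ} → Signed a₀ z → (∀ a → w a ≡ unitVec a₀ (toℚ z) a) → Decomposition v →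
              Decomposition (λ a → w a + v a)
    add-arc {a₀} {z} s e d = record
      { family = family ; slack = λ a → unitℤ a₀ z a ℤ.+ slack a ; tight = tight
      ; signed = λ a → Signed-+ (Signed-unitℤ s a) (signed a)
      ; value = λ a → trans (cong₂ _+_ (trans (e a) (sym (toℚ-unitℤ a₀ z a))) (value a))
          (trans (sym (toℚ-+ (unitℤ a₀ z a) (total a))) (cong toℚ (lemma (unitℤ a₀ z a)
            (ℤ.+ count (enter a) (family false)) (ℤ.+ count (enter a) (family true)) (slack a)))) }
      where
      open Decomposition d
      lemma : ∀ e f t z → e ℤ.+ (f ℤ.+ t ℤ.+ z) ≡ f ℤ.+ t ℤ.+ (e ℤ.+ z)
      lemma = ℤ-solve-∀

    vertexRow : Fin n → Row m
    vertexRow v = (if inS v then δ⁺ tail head (singleton tail head v) else cut (singleton tail head v)) , toℚ (ℤ.+ b v)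

    -- For v in S the row is δ⁺(v) = δ⁻(V ∖ {v}), so passing to the complement turns every vertex
    -- row into an entering cut.
    vertexSet : Bool → Fin n → Subset n
    vertexSet false v = singleton tail head v
    vertexSet true  v = Vec.map not (singleton tail head v)

    mem-vertexSet : ∀ side v w → mem side (vertexSet side v) w ≡ ⌊ v ≟ w ⌋
    mem-vertexSet false v w = lookup∘tabulate (λ w → ⌊ v ≟ w ⌋) w
    mem-vertexSet true  v w = trans (cong not (lookup-map w not (singleton tail head v)))
      (trans (not-involutive _) (lookup∘tabulate (λ w → ⌊ v ≟ w ⌋) w))

    vertexRow-cut : ∀ side v a → (if side then δ⁺ tail head (singleton tail head v) else cut (singleton tail head v)) a
                                 ≡ cut (vertexSet side v) a
    vertexRow-cut false v a = refl
    vertexRow-cut true  v a = cong indicator (sym (cong₂ _∧_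
      (trans (cong not (lookup-map (tail a) not (singleton tail head v))) (not-involutive _))
      (lookup-map (head a) not (singleton tail head v))))

    ≟-true : ∀ {v w : Fin n} → ⌊ v ≟ w ⌋ ≡ true → v ≡ w
    ≟-true {v} {w} h with v ≟ w
    ... | yes e = e

    ≟-refl : ∀ (v : Fin n) → ⌊ v ≟ v ⌋ ≡ true
    ≟-refl v with v ≟ v
    ... | yes _ = refl
    ... | no ¬e = ⊥-elim (¬e refl)

    vertex-TightCut : ∀ v → Tight rows x (vertexRow v) → TightCut (inS v) (vertexSet (inS v) v)
    vertex-TightCut v t =
      ((λ w h → cong inS (sym (is-v h))) , v , trans (mem-vertexSet (inS v) v v) (≟-refl v)) ,
      (vertexRow v , t , vertexRow-cut (inS v) v) ,
      inj₁ (λ w w′ h h′ → trans (sym (is-v h)) (is-v h′))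
      where
      is-v : ∀ {w} → mem (inS v) (vertexSet (inS v) v) w ≡ true → v ≡ w
      is-v {w} h = ≟-true (trans (sym (mem-vertexSet (inS v) v w)) h)

    add-row : ∀ {r v} → Tight rows x r → Decomposition v → Decomposition (λ a → proj₁ r a + v a)
    add-row {r} t@(r∈ , _) d with ∈-++⁻ (theSystem tail head inS b) r∈
    ... | inj₂ r∈box with ∈-++⁻ (map (λ a → unitVec a 1ℚ , l a) (allFin m)) r∈box
    ...   | inj₁ r∈l with ∈-map⁻ _ r∈l
    ...     | a , _ , refl = add-arc {a} {ℤ.1ℤ} (inj₁ (ℤ.+≤+ ℕ.z≤n) , inj₂ (r , t , λ _ → refl)) (λ _ → refl) d
    add-row {r} t@(r∈ , _) d | inj₂ r∈box | inj₂ r∈u with ∈-map⁻ _ r∈u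
    ...     | a , _ , refl = add-arc {a} {ℤ.-1ℤ} (inj₂ (r , t , λ _ → refl) , inj₁ ℤ.-≤+) (λ _ → refl) d
    add-row {r} t@(r∈ , tight) d | inj₁ r∈sys with ∈-++⁻ (map _ (allFin n)) r∈sys
    ... | inj₂ r∈sys′ with ∈-++⁻ (map (λ U → cut U , 1ℚ) (filterᵇ (isBicutSet tail head inS) (allSubsets n))) r∈sys′
    ...   | inj₂ r∈nn with ∈-map⁻ _ r∈nn
    ...     | a , _ , refl = add-arc {a} {ℤ.1ℤ} (inj₁ (ℤ.+≤+ ℕ.z≤n) , inj₂ (r , t , λ _ → refl)) (λ _ → refl) d
    add-row {r} t@(r∈ , tight) d | inj₁ r∈sys | inj₂ r∈sys′ | inj₁ r∈cut with ∈-map⁻ _ r∈cut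
    ...   | U , U∈ , refl =
      let side , s = bicut⇒SideSet inS tail head U
                       (Equivalence.to T-≡ (proj₂ (∈-filter⁻ (T? ∘ isBicutSet tail head inS) {xs = allSubsets n} U∈)))
      in add-cut side {U} (s , (r , t , λ _ → refl) , inj₂ (sym tight)) (λ _ → refl) d
    add-row {r} t@(r∈ , tight) d | inj₁ r∈sys | inj₁ r∈v with ∈-map⁻ _ r∈v
    ... | v , _ , refl = add-cut (inS v) {vertexSet (inS v) v} (vertex-TightCut v t) (vertexRow-cut (inS v) v) d

    decompose : ∀ L → All (Tight rows x) L → Decomposition (rowSum L)
    decompose [] [] = record
      { family = λ _ → [] ; slack = λ _ → ℤ.0ℤ ; tight = λ _ → [] ; signed = Signed-zero ; value = λ _ → refl }
    decompose (r ∷ L) (t ∷ ts) = add-row t (decompose L ts)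

  -- Laminarity on each side, and arcs as paths in the joined tree

  module Sides {n : ℕ} (inS : Fin n → Bool) where

    outside : ∀ {side v} U → SideSet inS side U → inS v ≡ not side → mem side U v ≡ false
    outside {side} {v} U (sub , _) h with mem side U v in e
    ... | false = refl
    ... | true  = ⊥-elim (b≢not-b side (trans (sym (sub v e)) h))
      where
      b≢not-b : ∀ p → p ≡ not p → ⊥
      b≢not-b false ()
      b≢not-b true  ()

    none-with : ∀ {U W : Subset n} p q → ¬ (∃ λ v → lookup U v ≡ p × lookup W v ≡ q) →
                ∀ v → lookup U v ≡ p → lookup W v ≡ not q
    none-with {U} {W} p q ¬∃ v Uv = ¬-not (λ Wv → ¬∃ (v , Uv , Wv))

    -- A vertex of the opposite class lies outside the members of both sets, so one region of a
    -- crossing is always present; the absence of another one means inclusion or disjointness. This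
    -- is where S and T have to be nonempty.
    laminar : ∀ side U W → (∃ λ v → inS v ≡ not side) → SideSet inS side U → SideSet inS side W →
              ¬ Crossing U W → Rounding.Laminar (mem side) U W
    laminar false U W (s , Ss) sU sW ¬c with exists-with U W true false | exists-with U W false true | exists-with U W true true
    ... | no ¬∃ | _ | _ = inj₁ (none-with {U} {W} true false ¬∃)
    ... | yes _ | no ¬∃ | _ = inj₂ (inj₁ λ v Wv → ¬-not λ Uv → ¬∃ (v , Uv , Wv))
    ... | yes _ | yes _ | no ¬∃ = inj₂ (inj₂ (none-with {U} {W} true true ¬∃))
    ... | yes p | yes q | yes i = ⊥-elim (¬c (p , q , i , s , outside U sU Ss , outside W sW Ss))
    laminar true U W (t , Tt) sU sW ¬c with exists-with U W true false | exists-with U W false true | exists-with U W false false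
    ... | no ¬∃ | _ | _ = inj₂ (inj₁ λ v Wv → cong not (¬-not λ Uv → ¬∃ (v , Uv , not-true Wv)))
    ... | yes _ | no ¬∃ | _ = inj₁ λ v Uv → cong not (none-with {U} {W} false true ¬∃ v (not-true Uv))
    ... | yes _ | yes _ | no ¬∃ = inj₂ (inj₂ λ v Uv → cong not (none-with {U} {W} false false ¬∃ v (not-true Uv)))
    ... | yes p | yes q | yes o = ⊥-elim (¬c (p , q , (t , not-false (outside U sU Tt) , not-false (outside W sW Tt)) , o))
      where
      not-false : ∀ {p} → not p ≡ false → p ≡ true
      not-false {true} _ = refl

    both : Bool → Fin n → Fin n → Subset n → Bool
    both side = Rounding.both (mem side)

    count-none : ∀ {A : Set} {p : A → Bool} {L} → All (λ U → p U ≡ false) L → count p L ≡ 0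
    count-none [] = refl
    count-none (e ∷ es) rewrite e = count-none es

    bothˡ-none : ∀ {side v} w {L} → All (SideSet inS side) L → inS v ≡ not side → count (both side v w) L ≡ 0
    bothˡ-none {side} {v} w sL h = count-none (All.map (λ {U} s → cong (_∧ mem side U w) (outside U s h)) sL)

    bothʳ-none : ∀ {side v} w {L} → All (SideSet inS side) L → inS v ≡ not side → count (both side w v) L ≡ 0
    bothʳ-none {side} {v} w sL h = count-none (All.map (λ {U} s →
      trans (cong (mem side U w ∧_) (outside U s h)) (∧-zeroʳ (mem side U w))) sL)

    module _ {m : ℕ} (tail head : Fin m → Fin n) where

      farEnd : Bool → Fin m → Fin n
      farEnd false = head
      farEnd true  = tail

      -- Along an arc, the sets of one side that it enters are those containing its far end but not both ends.
      count-enters : ∀ side a L → count (enters tail head a) L ℕ.+ count (both side (tail a) (head a)) L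
                                ≡ count (both side (farEnd side a) (farEnd side a)) L
      count-enters side a L = trans
        (sym (sumOf-+ (bit ∘ enters tail head a) (bit ∘ both side (tail a) (head a)) L))
        (sumOf-cong (pointwise side) L)
        where
        pointwise : ∀ side U → bit (enters tail head a U) ℕ.+ bit (both side (tail a) (head a) U)
                               ≡ bit (both side (farEnd side a) (farEnd side a) U)
        pointwise false U with lookup U (tail a) | lookup U (head a)
        ... | false | false = refl
        ... | false | true  = refl
        ... | true  | false = refl
        ... | true  | true  = refl
        pointwise true U with lookup U (tail a) | lookup U (head a)
        ... | false | false = refl
        ... | false | true  = refl
        ... | true  | false = refl
        ... | true  | true  = refl

      entering : (Bool → List (Subset n)) → Fin m → ℤ
      entering F a = ℤ.+ count (enters tail head a) (F false) ℤ.+ ℤ.+ count (enters tail head a) (F true)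

      -- An arc runs through the laminar tree of the complements of the S-side sets up to the root
      -- and then down the tree of the T-side sets; endPos and startPos are the signed depths at which it ends and starts.
      endPos startPos : (Bool → List (Subset n)) → Fin m → ℤ
      endPos   F a = ℤ.+ count (both false (head a) (head a)) (F false) ℤ.- ℤ.+ count (both true (tail a) (head a)) (F true)
      startPos F a = ℤ.+ count (both false (tail a) (head a)) (F false) ℤ.- ℤ.+ count (both true (tail a) (tail a)) (F true)

      -- By `count-enters`, adding the depth `d₀` or `d₁` of the common ancestor of the two ends to
      -- the number of sets entered gives the depth of the far end; these common depths cancel in
      -- the difference.
      entering-positions : ∀ F a → entering F a ≡ endPos F a ℤ.- startPos F a
      entering-positions F a = trans
        (lemma (ℤ.+ e₀) (ℤ.+ e₁) (ℤ.+ d₀) (ℤ.+ d₁))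
        (cong₂ (λ p q → p ℤ.- ℤ.+ d₁ ℤ.- (ℤ.+ d₀ ℤ.- q)) (sym-pos e₀ d₀ (count-enters false a (F false))) (sym-pos e₁ d₁ (count-enters true a (F true))))
        where
        e₀ = count (enters tail head a) (F false)
        e₁ = count (enters tail head a) (F true)
        d₀ = count (both false (tail a) (head a)) (F false)
        d₁ = count (both true (tail a) (head a)) (F true)
        sym-pos : ∀ e d {k} → e ℕ.+ d ≡ k → ℤ.+ e ℤ.+ ℤ.+ d ≡ ℤ.+ k
        sym-pos e d h = trans (sym (ℤ.pos-+ e d)) (cong ℤ.+_ h)
        lemma : ∀ e₀ e₁ d₀ d₁ → e₀ ℤ.+ e₁ ≡ e₀ ℤ.+ d₀ ℤ.- d₁ ℤ.- (d₀ ℤ.- (e₁ ℤ.+ d₁))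
        lemma = ℤ-solve-∀

      module _ (P : Bool → Subset n → Set) (P⇒SideSet : ∀ {side U} → P side U → SideSet inS side U)
               (M-1 : ℕ) (F : Bool → List (Subset n)) (all-P : ∀ side → All (P side) (F side))
               (lam : ∀ side → AllPairs (Rounding.Laminar (mem side)) (F side)) where

        open Floors M-1

        level : Bool → ℕ → ℕ
        level false = floor
        level true  = ceil

        -- Rounding only selects sets of the family, so `P` survives; tightness will take its place.
        rounded : ∀ side → ∃ λ L → All (P side) L ×
          (∀ s t → count (both side s t) L ≡ level side (count (both side s t) (F side)))
        rounded false = Rounding.round-laminar (mem false) floor refl floor-suc (F false) (lam false)
          (All.map (λ p → proj₂ (P⇒SideSet p)) (all-P false)) (all-P false)
        rounded true = Rounding.round-laminar (mem true) ceil refl ceil-suc (F true) (lam true)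
          (All.map (λ p → proj₂ (P⇒SideSet p)) (all-P true)) (all-P true)

        roundedFamily : Bool → List (Subset n)
        roundedFamily side = proj₁ (rounded side)

        side-sets : ∀ side → All (SideSet inS side) (F side)
        side-sets side = All.map P⇒SideSet (all-P side)

        position-rounded : ∀ s t s′ t′ →
          count (both false s t) (F false) ≡ 0 ⊎ count (both true s′ t′) (F true) ≡ 0 →
          IsFloor (ℤ.+ count (both false s t) (F false) ℤ.- ℤ.+ count (both true s′ t′) (F true))
                  (ℤ.+ count (both false s t) (roundedFamily false) ℤ.- ℤ.+ count (both true s′ t′) (roundedFamily true))
        position-rounded s t s′ t′ h = subst₂ (λ p q → IsFloor _ (ℤ.+ p ℤ.- ℤ.+ q))
          (sym (proj₂ (proj₂ (rounded false)) s t)) (sym (proj₂ (proj₂ (rounded true)) s′ t′))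
          (floor-ceil-IsFloor _ _ h)

        -- The head is in S or in T, hence in no set of the opposite side, so one of the two depths
        -- vanishes.
        endPos-rounded : ∀ a → IsFloor (endPos F a) (endPos roundedFamily a)
        endPos-rounded a = position-rounded (head a) (head a) (tail a) (head a) (split-on (inS (head a)) refl)
          where
          split-on : ∀ p → inS (head a) ≡ p → count (both false (head a) (head a)) (F false) ≡ 0 ⊎
                                             count (both true (tail a) (head a)) (F true) ≡ 0
          split-on true  h = inj₁ (bothˡ-none (head a) (side-sets false) h)
          split-on false h = inj₂ (bothʳ-none (tail a) (side-sets true) h)

        startPos-rounded : ∀ a → IsFloor (startPos F a) (startPos roundedFamily a)
        startPos-rounded a = position-rounded (tail a) (head a) (tail a) (tail a) (split-on (inS (tail a)) refl)
          where
          split-on : ∀ p → inS (tail a) ≡ p → count (both false (tail a) (head a)) (F false) ≡ 0 ⊎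
                                             count (both true (tail a) (tail a)) (F true) ≡ 0
          split-on true  h = inj₁ (bothˡ-none (head a) (side-sets false) h)
          split-on false h = inj₂ (bothˡ-none (tail a) (side-sets true) h)

        -- The residue on `a` is M c minus the cuts before rounding and c minus the cuts after it.
        -- As its sign carries over, the same tight row can pay for it.
        entering-nonNeg : ∀ a c → ℤ.0ℤ ℤ.≤ ℤ.+ M ℤ.* c ℤ.- entering F a → ℤ.0ℤ ℤ.≤ c ℤ.- entering roundedFamily a
        entering-nonNeg a c h = subst (λ e → ℤ.0ℤ ℤ.≤ c ℤ.- e) (sym (entering-positions roundedFamily a))
          (round-nonNeg c (endPos-rounded a) (startPos-rounded a)
            (subst (λ e → ℤ.0ℤ ℤ.≤ ℤ.+ M ℤ.* c ℤ.- e) (entering-positions F a) h))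

        entering-nonPos : ∀ a c → ℤ.+ M ℤ.* c ℤ.- entering F a ℤ.≤ ℤ.0ℤ → c ℤ.- entering roundedFamily a ℤ.≤ ℤ.0ℤ
        entering-nonPos a c h = subst (λ e → c ℤ.- e ℤ.≤ ℤ.0ℤ) (sym (entering-positions roundedFamily a))
          (round-nonPos c (endPos-rounded a) (startPos-rounded a)
            (subst (λ e → ℤ.+ M ℤ.* c ℤ.- e ℤ.≤ ℤ.0ℤ) (entering-positions F a) h))

  -- Rounding the decomposition of M c and reading off the integral dual optimum

  scaled-unit : ∀ {m} k q (a a′ : Fin m) → k * unitVec a q a′ ≡ unitVec a (k * q) a′
  scaled-unit k q a a′ = scale-if ⌊ a ≟ a′ ⌋
    where
    scale-if : ∀ p → k * (if p then q else 0ℚ) ≡ (if p then k * q else 0ℚ)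
    scale-if true  = refl
    scale-if false = *-zeroʳ k

  module Optimum {n m : ℕ} (tail head : Fin m → Fin n) (inS : Fin n → Bool)
                 (S≢∅ : ∃ λ v → inS v ≡ true) (T≢∅ : ∃ λ v → inS v ≡ false)
                 (b : Fin n → ℕ) (l u x : Fin m → ℚ)
                 (feasible : Feasible (theSystem tail head inS b ++ boxRows l u) x)
                 (c : Fin m → ℤ)
                 (optimal : ∀ x′ → Feasible (theSystem tail head inS b ++ boxRows l u) x′ →
                            dot (λ a → toℚ (c a)) x ≤ dot (λ a → toℚ (c a)) x′) where

    open TightRows tail head inS b l u x feasible
    open Sides inS

    side≢∅ : ∀ side → ∃ λ v → inS v ≡ not side
    side≢∅ false = S≢∅
    side≢∅ true  = T≢∅

    Uncrossed : Bool → List (Subset n) → Set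
    Uncrossed side F = ∃ λ F′ → ∃ λ (z : Fin m → ℕ) →
      All (TightCut side) F′ × AllPairs (λ U W → ¬ Crossing U W) F′ ×
      (∀ a → count (enter a) F ≡ count (enter a) F′ ℕ.+ z a) × (∀ a → z a ≡ 0 ⊎ x a ≡ 0ℚ)

    uncrossed : ∀ side F → All (TightCut side) F → Uncrossed side F
    uncrossed side F = uncrossing tail head (TightCut side) (λ a → x a ≡ 0ℚ)
      (λ {U} {W} → tight-uncross side {U} {W}) (suc (sumOf weight F)) F ℕ.≤-refl

    laminar-tight : ∀ side {F} → All (TightCut side) F → AllPairs (λ U W → ¬ Crossing U W) F →
                    AllPairs (Rounding.Laminar (mem side)) F
    laminar-tight side [] [] = []
    laminar-tight side {U ∷ F} (t ∷ ts) (nc ∷ ncs) =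
      All.zipWith (λ {W} (tW , ¬c) → laminar side U W (side≢∅ side) (proj₁ t) (proj₁ tW) ¬c) (ts , nc) ∷
      laminar-tight side ts ncs

    null-Signed : ∀ {a z} → z ≡ 0 ⊎ x a ≡ 0ℚ → Signed a (ℤ.+ z)
    null-Signed {a} (inj₁ refl) = Signed-zero a
    null-Signed {a} (inj₂ e)    = inj₁ (ℤ.+≤+ ℕ.z≤n) , inj₂ (null⇒Lower a e)

    -- Uncrossing makes the families laminar at the price of additional slack on arcs with x = 0.
    -- Rounding then divides by M without changing the sign of the residue on any arc for the worse:
    -- nonnegative stays nonnegative, nonpositive stays nonpositive.
    round-decomposition : ∀ M-1 (v : Fin m → ℚ) → Decomposition v → (∀ a → toℚ (ℤ.+ suc M-1 ℤ.* c a) ≡ v a) →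
                          Decomposition (λ a → toℚ (c a))
    round-decomposition M-1 v d Mc≡v = record
      { family = F″
      -- The slack is whatever the rounded cuts leave of c, so `value` holds by construction and the
      -- content lies in `signed`.
      ; slack  = λ a → c a ℤ.- entering tail head F″ a
      ; tight  = λ side → proj₁ (proj₂ (rounded″ side))
      ; signed = λ a →
          Sum.map₁ (entering-nonNeg″ a) (proj₁ (residue-Signed a)) ,
          Sum.map₁ (entering-nonPos″ a) (proj₂ (residue-Signed a))
      ; value  = λ a → cong toℚ (lemma (c a) (entering tail head F″ a)) }
      where
      open Decomposition d
      unc : ∀ side → Uncrossed side (family side)
      unc side = uncrossed side (family side) (tight side)
      F′ : Bool → List (Subset n)
      F′ side = proj₁ (unc side)
      z : Bool → Fin m → ℕ
      z side = proj₁ (proj₂ (unc side))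
      tight′ : ∀ side → All (TightCut side) (F′ side)
      tight′ side = proj₁ (proj₂ (proj₂ (unc side)))
      lam : ∀ side → AllPairs (Rounding.Laminar (mem side)) (F′ side)
      lam side = laminar-tight side (tight′ side) (proj₁ (proj₂ (proj₂ (proj₂ (unc side)))))
      rounded″ = rounded tail head TightCut proj₁ M-1 F′ tight′ lam
      F″ : Bool → List (Subset n)
      F″ = roundedFamily tail head TightCut proj₁ M-1 F′ tight′ lam
      residue : ∀ a → ℤ.+ suc M-1 ℤ.* c a ℤ.- entering tail head F′ a ≡ ℤ.+ z false a ℤ.+ ℤ.+ z true a ℤ.+ slack a
      residue a = trans (cong (ℤ._- entering tail head F′ a) (toℚ-injective {ℤ.+ suc M-1 ℤ.* c a} {total a} (trans (Mc≡v a) (value a))))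
        (trans (cong₂ (λ p q → p ℤ.+ q ℤ.+ slack a ℤ.- entering tail head F′ a) (split-count false) (split-count true))
          (lemma′ (ℤ.+ count (enter a) (F′ false)) (ℤ.+ count (enter a) (F′ true)) (ℤ.+ z false a) (ℤ.+ z true a) (slack a)))
        where
        split-count : ∀ side → ℤ.+ count (enter a) (family side) ≡ ℤ.+ count (enter a) (F′ side) ℤ.+ ℤ.+ z side a
        split-count side = trans (cong ℤ.+_ (proj₁ (proj₂ (proj₂ (proj₂ (proj₂ (unc side))))) a)) (ℤ.pos-+ (count (enter a) (F′ side)) (z side a))
        lemma′ : ∀ e₀ e₁ z₀ z₁ s → (e₀ ℤ.+ z₀) ℤ.+ (e₁ ℤ.+ z₁) ℤ.+ s ℤ.- (e₀ ℤ.+ e₁) ≡ z₀ ℤ.+ z₁ ℤ.+ s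
        lemma′ = ℤ-solve-∀
      residue-Signed : ∀ a → Signed a (ℤ.+ suc M-1 ℤ.* c a ℤ.- entering tail head F′ a)
      residue-Signed a = subst (Signed a) (sym (residue a))
        (Signed-+ (Signed-+ (null-Signed (null false)) (null-Signed (null true))) (signed a))
        where
        null : ∀ side → z side a ≡ 0 ⊎ x a ≡ 0ℚ
        null side = proj₂ (proj₂ (proj₂ (proj₂ (proj₂ (unc side))))) a
      entering-nonNeg″ : ∀ a → ℤ.0ℤ ℤ.≤ ℤ.+ suc M-1 ℤ.* c a ℤ.- entering tail head F′ a → ℤ.0ℤ ℤ.≤ c a ℤ.- entering tail head F″ a
      entering-nonNeg″ a = entering-nonNeg tail head TightCut proj₁ M-1 F′ tight′ lam a (c a)
      entering-nonPos″ : ∀ a → ℤ.+ suc M-1 ℤ.* c a ℤ.- entering tail head F′ a ℤ.≤ ℤ.0ℤ → c a ℤ.- entering tail head F″ a ℤ.≤ ℤ.0ℤ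
      entering-nonPos″ a = entering-nonPos tail head TightCut proj₁ M-1 F′ tight′ lam a (c a)
      lemma : ∀ c e → c ≡ e ℤ.+ (c ℤ.- e)
      lemma = ℤ-solve-∀

    Dual : (Fin m → ℚ) → Set
    Dual = IntegralDual rows x

    cuts-Dual : ∀ side F → All (TightCut side) F → Dual (λ a → toℚ (ℤ.+ count (enter a) F))
    cuts-Dual side [] [] = IntegralDual-zero rows x
    cuts-Dual side (U ∷ F) ((_ , row , _) ∷ ts) = IntegralDual-resp rows x
      (λ a → trans (cong (_+ toℚ (ℤ.+ count (enter a) F)) (indicator-toℚ (enter a U)))
                   (sym (toℚ-+ (ℤ.+ bit (enter a U)) (ℤ.+ count (enter a) F))))
      (IntegralDual-+ rows x (IntegralDual-row rows x row) (cuts-Dual side F ts))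

    arc-Dual : ∀ a z → Signed a z → Dual (unitVec a (toℚ z))
    arc-Dual a (ℤ.+ zero) _ = IntegralDual-resp rows x (λ a′ → sym (unit-zero ⌊ a ≟ a′ ⌋)) (IntegralDual-zero rows x)
      where
      unit-zero : ∀ p → (if p then 0ℚ else 0ℚ) ≡ 0ℚ
      unit-zero true  = refl
      unit-zero false = refl
    arc-Dual a ℤ.+[1+ k ] (_ , inj₁ (ℤ.+≤+ ()))
    arc-Dual a ℤ.+[1+ k ] (_ , inj₂ lower) = IntegralDual-resp rows x
      (λ a′ → trans (scaled-unit (toℚ ℤ.+[1+ k ]) 1ℚ a a′) (cong (λ q → unitVec a q a′) (*-identityʳ (toℚ ℤ.+[1+ k ]))))
      (IntegralDual-* rows x (suc k) (IntegralDual-row rows x lower))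
    arc-Dual a ℤ.-[1+ k ] (inj₁ () , _)
    arc-Dual a ℤ.-[1+ k ] (inj₂ upper , _) = IntegralDual-resp rows x
      (λ a′ → trans (scaled-unit (toℚ ℤ.+[1+ k ]) (- 1ℚ) a a′) (cong (λ q → unitVec a q a′)
        (trans (sym (toℚ-* ℤ.+[1+ k ] ℤ.-1ℤ)) (cong toℚ (trans (ℤ.*-comm ℤ.+[1+ k ] ℤ.-1ℤ) (ℤ.-1*i≡-i ℤ.+[1+ k ]))))))
      (IntegralDual-* rows x (suc k) (IntegralDual-row rows x upper))

    decomposition-Dual : ∀ {v} → Decomposition v → Dual v
    decomposition-Dual {v} d = IntegralDual-resp rows x
      (λ a → trans (cong (toℚ (f a) + toℚ (t a) +_) (∑-unitVec (λ i → toℚ (slack i)) a))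
        (sym (trans (value a) (trans (toℚ-+ (f a ℤ.+ t a) (slack a)) (cong (_+ toℚ (slack a)) (toℚ-+ (f a) (t a)))))))
      (IntegralDual-+ rows x
        (IntegralDual-+ rows x (cuts-Dual false (family false) (tight false)) (cuts-Dual true (family true) (tight true)))
        (IntegralDual-∑ rows x (λ i → unitVec i (toℚ (slack i))) (λ i → arc-Dual i (slack i) (signed i))))
      where
      open Decomposition d
      f t : Fin m → ℤ
      f a = ℤ.+ count (enter a) (family false)
      t a = ℤ.+ count (enter a) (family true)

    cost-Decomposition : Decomposition (λ a → toℚ (c a))
    cost-Decomposition = from-rows (Duality.cost-from-tight-rows rows (λ a → toℚ (c a)) x feasible optimal)
      where
      from-rows : (∃₂ λ M L → M ≢ 0 × All (Tight rows x) L × ∀ a → ⟦ M ⟧ * toℚ (c a) ≡ rowSum L a) →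
                  Decomposition (λ a → toℚ (c a))
      from-rows (zero , L , M≢0 , _) = ⊥-elim (M≢0 refl)
      from-rows (suc M-1 , L , _ , tight , e) = round-decomposition M-1 (rowSum L) (decompose L tight)
        (λ a → trans (toℚ-* (ℤ.+ suc M-1) (c a)) (trans (cong (_* toℚ (c a)) (sym (⟦⟧-toℚ (suc M-1)))) (e a)))

    integral-optimum : IntegralDualOptimum rows (λ a → toℚ (c a))
    integral-optimum = from-dual (decomposition-Dual cost-Decomposition)
      where
      from-dual : Dual (λ a → toℚ (c a)) → IntegralDualOptimum rows (λ a → toℚ (c a))
      from-dual (y , nn , eq , obj) = y , ((λ i → toℚ-mono-≤ {ℤ.0ℤ} (nn i)) , eq) ,
        λ y′ d → ≤-trans (weak-duality rows x feasible y′ d) (≤-reflexive (sym obj))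

open DualSolutions using (module Optimum)
open import Data.Nat using (ℕ; _<_)
open import Data.Fin using (Fin)
open import Data.Bool using (Bool; true; false)
open import Data.Product using (∃; _,_)
open import Relation.Binary.PropositionalEquality using (_≡_; _≢_)

theorem10 : (n m : ℕ) (tail head : Fin m → Fin n) →
    (∀ a → tail a ≢ head a) →
    (inS : Fin n → Bool) →
    (∃ λ v → inS v ≡ true) → (∃ λ v → inS v ≡ false) →
    (b : Fin n → ℕ) → (∀ v → 0 < b v) →
    BoxTDI (theSystem tail head inS b)
theorem10 n m tail head _ inS S≢∅ T≢∅ b _ l u c (x , feasible , optimal) =
  Optimum.integral-optimum tail head inS S≢∅ T≢∅ b l u x feasible c optimal
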